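{- Let $G$ be an $s$-$t$ DAG. The following statements are equivalent: (1) $G$ is width-stable; (2) $G$ has paths of large weight: for any non-zero flow $X\ge 0$ on $G$, there exists an $s$-$t$ path in $G|_X$ carrying $|X|/\mathrm{width}(G|_X)$ flow; (3) $G$ has no funnel subgraph with a central path.
   Context: An $s$-$t$ DAG is a directed acyclic graph $G=(V,E)$ with a unique source $s$ (no in-edges) and a unique sink $t$ (no out-edges). A flow is a function $X$ on $E$ (integer-valued) such that at every node of $V\setminus\{s,t\}$ incoming flow equals outgoing flow; $|X|$ is the total flow out of $s$. $X\le Y$ means $X(e)\le Y(e)$ for all $e\in E$. For a non-negative flow $X$ on $G$, $G|_X$ is the spanning subgraph of $G$ consisting of the edges $e$ with $X(e)\neq 0$, and $\mathrm{width}(G|_X)$ is the minimum number of $s$-$t$ paths in $G|_X$ needed to cover all edges of $G|_X$. A path $P$ carries flow $p$ if $X(e)\ge p$ for every edge $e$ of $P$. $G$ is width-stable if for any non-negative flows $X\le Y$ on $G$ it holds that $\mathrm{width}(G|_X)\le\mathrm{width}(G|_Y)$. An $s$-$t$ DAG is a funnel if every $s$-$t$ path has a private edge, i.e. an edge not contained in any other $s$-$t$ path. A funnel subgraph of $G$ is a subgraph $F$ of $G$ that is a funnel (as an $s$-$t$ DAG). A node of $F$ is forking in $F$ if its out-degree in $F$ is greater than $1$, and merging in $F$ if its in-degree in $F$ is greater than $1$. A central path of a funnel subgraph $F$ of $G$ is a path in $G$ from a node that is merging in $F$ to a node that is forking in $F$. -}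

module Defs where

open import Data.Fin using (Fin)
open import Data.Fin.Properties using (_≟_)
open import Data.Fin.Subset using (Subset; _∈_; ⊤)
open import Data.Fin.Subset.Properties using (_∈?_; ∈⊤)
open import Data.Integer using (+_)
open import Data.List using (List; []; _∷_; allFin; filter; length; map; sum)
open import Data.List.Membership.Propositional using () renaming (_∈_ to _∈ₗ_; _∉_ to _∉ₗ_)
open import Data.List.Relation.Unary.All using (All)
open import Data.List.Relation.Unary.Any using (Any)
open import Data.Nat using (ℕ; zero; suc; _≤_; _<_; NonZero)
import Data.Nat.Properties as ℕ
open import Data.Product using (∃-syntax; _×_; _,_)
open import Data.Rational using (ℚ; _/_) renaming (_≤_ to _≤ℚ_)
open import Data.Vec using (tabulate)
open import Data.Vec.Properties using (lookup∘tabulate; lookup⇒[]=)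
open import Relation.Binary.PropositionalEquality using (_≡_; _≢_; refl; trans)
open import Relation.Nullary using (¬_; ¬?; _×-dec_; does)
open import Relation.Nullary.Decidable using (dec-true)
open import Relation.Nullary.Negation using (contradiction)

-- Parallel edges are not excluded.
record Digraph : Set where
  field
    #V #E   : ℕ
    src tgt : Fin #E → Fin #V

  V = Fin #V
  E = Fin #E

open Digraph public using (V; E)

record Subgraph (D : Digraph) : Set where
  open Digraph D hiding (V; E)
  field
    vertices : Subset #V
    edges    : Subset #E
    src∈     : ∀ {e} → e ∈ edges → src e ∈ vertices
    tgt∈     : ∀ {e} → e ∈ edges → tgt e ∈ vertices

spanning : (D : Digraph) → Subset (Digraph.#E D) → Subgraph D
spanning D es = record
  { vertices = ⊤
  ; edges    = es
  ; src∈     = λ _ → ∈⊤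
  ; tgt∈     = λ _ → ∈⊤
  }

whole : (D : Digraph) → Subgraph D
whole D = spanning D ⊤

module _ {D : Digraph} (H : Subgraph D) where
  open Digraph D using (src; tgt)
  open Subgraph H

  -- A path is given by its list of edges. Vertices may repeat a priori, but
  -- acyclicity rules this out in every graph considered below.
  IsPath : V D → V D → List (E D) → Set
  IsPath u v []      = u ≡ v × u ∈ vertices
  IsPath u v (e ∷ p) = e ∈ edges × src e ≡ u × IsPath (tgt e) v p

  inEdges outEdges : V D → List (E D)
  inEdges  v = filter (λ e → (e ∈? edges) ×-dec (tgt e ≟ v)) (allFin _)
  outEdges v = filter (λ e → (e ∈? edges) ×-dec (src e ≟ v)) (allFin _)

  IsMerging IsForking : V D → Set
  IsMerging v = 1 < length (inEdges v)
  IsForking v = 1 < length (outEdges v)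

  IsSource IsSink : V D → Set
  IsSource v = v ∈ vertices × (∀ {e} → e ∈ edges → tgt e ≢ v)
  IsSink   v = v ∈ vertices × (∀ {e} → e ∈ edges → src e ≢ v)

  record IsSTDAG (s t : V D) : Set where
    field
      acyclic       : ∀ {v p} → IsPath v v p → p ≡ []
      source        : IsSource s
      source-unique : ∀ {v} → IsSource v → v ≡ s
      sink          : IsSink t
      sink-unique   : ∀ {v} → IsSink v → v ≡ t

  IsPrivateEdge : (s t : V D) → List (E D) → E D → Set
  IsPrivateEdge s t p e =
    e ∈ₗ p × (∀ {q} → IsPath s t q → q ≢ p → e ∉ₗ q)

  record IsFunnel (s t : V D) : Set where
    field
      isSTDAG : IsSTDAG s t
      private-edge : ∀ {p} → IsPath s t p → ∃[ e ] IsPrivateEdge s t p e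

  record IsPathCover (s t : V D) (ps : List (List (E D))) : Set where
    field
      paths  : All (IsPath s t) ps
      covers : ∀ {e} → e ∈ edges → Any (e ∈ₗ_) ps

  record IsWidth (s t : V D) (w : ℕ) : Set where
    field
      attained : ∃[ ps ] IsPathCover s t ps × length ps ≡ w
      minimal  : ∀ {ps} → IsPathCover s t ps → w ≤ length ps

record STDAG : Set where
  field
    digraph : Digraph
    s t     : V digraph
    isSTDAG : IsSTDAG (whole digraph) s t

  open Digraph digraph public hiding (V; E)

  full : Subgraph digraph
  full = whole digraph

module _ (G : STDAG) where
  open STDAG G

  -- Only non-negative flows are needed, so the integer values are taken in ℕ.
  record Flow : Set where
    field
      on       : E digraph → ℕ
      conserve : ∀ v → v ≢ s → v ≢ t →
                 sum (map on (inEdges full v)) ≡ sum (map on (outEdges full v))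

  -- A funnel subgraph is an s′-t′ DAG for its own source s′ and sink t′, which
  -- need not be those of G.
  IsFunnelSubgraph : Subgraph digraph → Set
  IsFunnelSubgraph F = ∃[ s′ ] ∃[ t′ ] IsFunnel F s′ t′

  -- The path lives in G and may leave F.
  HasCentralPath : Subgraph digraph → Set
  HasCentralPath F =
    ∃[ u ] ∃[ v ] ∃[ p ] IsMerging F u × IsForking F v × IsPath full u v p

  NoFunnelWithCentralPath : Set
  NoFunnelWithCentralPath = ¬ (∃[ F ] IsFunnelSubgraph F × HasCentralPath F)

module _ {G : STDAG} where
  open STDAG G
  open Flow

  ∣_∣ : Flow G → ℕ
  ∣ X ∣ = sum (map (on X) (outEdges full s))

  _≤F_ : Flow G → Flow G → Set
  X ≤F Y = ∀ e → on X e ≤ on Y e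

  IsNonZero : Flow G → Set
  IsNonZero X = ∃[ e ] on X e ≢ 0

  support : Flow G → Subgraph digraph
  support X = spanning digraph (tabulate λ e → does (¬? (on X e ℕ.≟ 0)))

  IsFlowWidth : Flow G → ℕ → Set
  IsFlowWidth X = IsWidth (support X) s t

  Carries : Flow G → List (E digraph) → ℚ → Set
  Carries X P p = ∀ {e} → e ∈ₗ P → p ≤ℚ (+ on X e / 1)

  width-nonZero : ∀ X → IsNonZero X → ∀ {w} → IsFlowWidth X w → NonZero w
  width-nonZero X (e , Xe≢0) {suc w} _     = _
  width-nonZero X (e , Xe≢0) {zero}  width with IsWidth.attained width
  ... | [] , cover , _ = contradiction (IsPathCover.covers cover e∈) λ ()
    where
    e∈ : e ∈ Subgraph.edges (support X)
    e∈ = lookup⇒[]= e _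
           (trans (lookup∘tabulate _ e) (dec-true (¬? (on X e ℕ.≟ 0)) Xe≢0))

module _ (G : STDAG) where
  open STDAG G

  WidthStable : Set
  WidthStable = ∀ (X Y : Flow G) → X ≤F Y →
    ∀ {w w′} → IsFlowWidth X w → IsFlowWidth Y w′ → w ≤ w′

  HasPathsOfLargeWeight : Set
  HasPathsOfLargeWeight =
    ∀ (X : Flow G) (X≢0 : IsNonZero X) {w} (width : IsFlowWidth X w) →
    let instance w≢0 = width-nonZero X X≢0 width in
    ∃[ P ] IsPath (support X) s t P × Carries X P (+ ∣ X ∣ / w)

{-# OPTIONS --safe #-}
-- (1) ⇒ (3).  In a funnel with a central path from a merging node u to a forking node v, take two
-- paths through u and two through v.  Their four private edges cannot share paths, so their union
-- has width 4.  Adding the central path allows three paths to cover everything: one of the paths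
-- into u is continued along the central path by one of the paths out of v.
--
-- (2) ⇒ (1).  If X ≤ Y but w = width X > w′ = width Y, let X₀ be the sum of a minimum path cover of
-- G|_X.  For large M, a path carrying a w′-th of M X₀ + Y has X₀ ≥ 2 everywhere, so subtracting it
-- from X₀ leaves a flow with the same support that decomposes into w − 1 paths.
--
-- (3) ⇒ (2).  If no path carries |X| / w, there are disjoint vertex sets A ∋ s and B ∋ t such that A
-- is reachable from s inside A, B reaches t inside B, and all edges leaving A end in B and are light;
-- hence the set C of these edges has more than w elements.  C together with a spanning out-tree τ of
-- A and a spanning in-tree σ of B is (after pruning) a funnel.  Call a vertex of B (A) branching if
-- it has two edges of C above it in σ (below it in τ).  A path in G|_X from a branching vertex of B
-- to a branching vertex of A gives a central path.  If there is none, then the cut can be shifted so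
-- that no path of G|_X returns across it, and each edge of C is traded for its own edge of the new
-- cut.  These more than w edges form an antichain of G|_X, which therefore has width more than w.
module Submission where

open import Defs
open import Data.Bool using (if_then_else_)
open import Data.Empty using (⊥)
open import Data.Fin using (Fin)
open import Data.Fin.Induction using (spo-wellFounded; spo-noetherian)
open import Data.Fin.Properties using (_≟_; any?; injective⇒≤)
open import Data.Fin.Subset using (_∈_; ⊤)
open import Data.Fin.Subset.Properties using (_∈?_; ∈⊤)
import Data.Integer as ℤ
import Data.Integer.Properties as ℤ
open import Data.List using (List; []; _∷_; _∷ʳ_; _++_; allFin; filter; length; lookup; map)
open import Data.List.Membership.Propositional using (find; lose) renaming (_∈_ to _∈ₗ_; _∉_ to _∉ₗ_)
open import Data.List.Membership.Propositional.Properties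
  using (∈-∃++; ∈-++⁺ʳ; ∈-++⁺ˡ; ∈-++⁻; ∈-filter⁺; ∈-filter⁻; ∈-allFin; ∈-lookup)
open import Data.List.Properties
  using (≡-dec; map-cong; ++-cancelˡ; ++-cancelʳ; ++-conicalʳ; ∷-injective; ∷-injectiveˡ; ∷ʳ-injectiveʳ)
open import Data.List.Relation.Unary.All as All using (All; []; _∷_)
open import Data.List.Relation.Unary.All.Properties using (++⁺; ++⁻; ∷ʳ⁺; ∷ʳ⁻; map⁺; ¬Any⇒All¬)
open import Data.List.Relation.Unary.AllPairs using ([]; _∷_)
open import Data.List.Relation.Unary.Any as Any using (Any; here; there)
import Data.List.Relation.Unary.Any.Properties as Anyₚ
open import Data.List.Relation.Unary.Unique.Propositional using (Unique)
open import Data.List.Relation.Unary.Unique.Propositional.Properties using (allFin⁺; filter⁺)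
open import Data.List.Reverse using (Reverse; reverseView; []; _∶_∶ʳ_)
open import Data.Maybe using (Maybe; just; nothing)
open import Data.Maybe.Properties using (just-injective) renaming (≡-dec to Maybe-≡-dec)
open import Data.Nat using (ℕ; zero; suc; NonZero; _+_; _*_; _∸_; _≤_; _<_; z≤n; s≤s; _≤?_)
open import Data.Nat.Induction using (<-wellFounded)
open import Data.Nat.ListAction using (sum)
import Data.Nat.Properties as ℕ
open import Data.Nat.Tactic.RingSolver using (solve-∀)
open import Data.Product using (∃-syntax; _×_; _,_; proj₁; proj₂)
open import Data.Rational using (_/_) renaming (_≤_ to _≤ℚ_)
import Data.Rational.Properties as ℚ
open import Data.Rational.Unnormalised using (mkℚᵘ; *≤*)
import Data.Rational.Unnormalised.Properties as ℚᵘ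
open import Data.Sum as Sum using (_⊎_; inj₁; inj₂)
open import Data.Vec using (tabulate)
open import Data.Vec.Properties using (lookup∘tabulate; lookup⇒[]=; []=⇒lookup; tabulate-cong)
open import Function using (case_of_; flip; id; _∘_)
open import Function.Bundles using (_⇔_; mk⇔)
open import Induction.WellFounded using (WellFounded; Acc; acc)
open import Relation.Binary.PropositionalEquality
  using (_≡_; _≢_; refl; sym; trans; cong; cong₂; subst; subst₂; isEquivalence; module ≡-Reasoning)
open import Relation.Binary.Structures using (IsStrictPartialOrder)
open import Relation.Nullary using (¬_; Dec; yes; no; does; ¬?; _×-dec_; _⊎-dec_)
open import Relation.Nullary.Decidable using (dec-true; dec-false; decidable-stable; does-⇔; map′)
open import Relation.Nullary.Negation using (contradiction)
open import Relation.Unary using (Decidable)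

private variable
  I K P Q : Set

-- Lists: counting by representatives, and comparing factorisations.

lookup-injective : {xs : List I} → Unique xs → ∀ i j → lookup xs i ≡ lookup xs j → i ≡ j
lookup-injective (x∉ ∷ u) Fin.zero    Fin.zero    _  = refl
lookup-injective (x∉ ∷ u) Fin.zero    (Fin.suc j) eq =
  contradiction eq (All.lookup x∉ (∈-lookup j))
lookup-injective (x∉ ∷ u) (Fin.suc i) Fin.zero    eq =
  contradiction (sym eq) (All.lookup x∉ (∈-lookup i))
lookup-injective (x∉ ∷ u) (Fin.suc i) (Fin.suc j) eq =
  cong Fin.suc (lookup-injective u i j eq)

-- Pigeonhole, and the source of both lower bounds on width: sending each `x` to a path of the cover
-- through one of its representatives is injective. `Φ` is a relation because a representative is
-- only known to exist.
length-≤-cover : {xs : List I} {ps : List (List K)} (Φ : I → K → Set) → Unique xs →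
  (∀ {x} → x ∈ₗ xs → ∃[ e ] Φ x e × Any (e ∈ₗ_) ps) →
  (∀ {x y e f p} → Φ x e → Φ y f → p ∈ₗ ps → e ∈ₗ p → f ∈ₗ p → x ≡ y) →
  length xs ≤ length ps
length-≤-cover {xs = xs} {ps} Φ u cover separated = injective⇒≤ {f = f} f-injective
  where
  choice : ∀ i → ∃[ e ] Φ (lookup xs i) e × Any (e ∈ₗ_) ps
  choice i = cover (∈-lookup i)

  f : Fin (length xs) → Fin (length ps)
  f i = Any.index (proj₂ (proj₂ (choice i)))

  f-injective : ∀ {i j} → f i ≡ f j → i ≡ j
  f-injective {i} {j} eq =
    let e , Φe , e∈ = choice i
        e′ , Φe′ , e′∈ = choice j
    in lookup-injective u i j (separated Φe Φe′ (∈-lookup (f i)) (Anyₚ.lookup-index e∈)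
         (subst (λ k → e′ ∈ₗ lookup ps k) (sym eq) (Anyₚ.lookup-index e′∈)))

++-compare : (xs {ys} zs {ws} : List I) → xs ++ ys ≡ zs ++ ws →
  (∃[ k ] zs ≡ xs ++ k × ys ≡ k ++ ws) ⊎ (∃[ k ] xs ≡ zs ++ k × ws ≡ k ++ ys)
++-compare []       zs       eq = inj₁ (zs , refl , eq)
++-compare (x ∷ xs) []       eq = inj₂ (x ∷ xs , refl , sym eq)
++-compare (x ∷ xs) (z ∷ zs) eq with refl , eq′ ← ∷-injective eq with ++-compare xs zs eq′
... | inj₁ (k , refl , eq₂) = inj₁ (k , refl , eq₂)
... | inj₂ (k , refl , eq₂) = inj₂ (k , refl , eq₂)

-- Sums

-- Iverson bracket. It turns sums over incident edges into sums over all edges, whose order can be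
-- exchanged.
⟦_⟧ : Dec P → ℕ
⟦ P? ⟧ = if does P? then 1 else 0

⟦⟧-yes : (P? : Dec P) → P → ⟦ P? ⟧ ≡ 1
⟦⟧-yes P? p rewrite dec-true P? p = refl

⟦⟧-no : (P? : Dec P) → ¬ P → ⟦ P? ⟧ ≡ 0
⟦⟧-no P? ¬p rewrite dec-false P? ¬p = refl

⟦⟧≤1 : (P? : Dec P) → ⟦ P? ⟧ ≤ 1
⟦⟧≤1 (no _)  = z≤n
⟦⟧≤1 (yes _) = ℕ.≤-refl

⟦⟧-mono : (P? : Dec P) (Q? : Dec Q) → (P → Q) → ⟦ P? ⟧ ≤ ⟦ Q? ⟧
⟦⟧-mono (no _)  Q? f = z≤n
⟦⟧-mono (yes p) Q? f = ℕ.≤-reflexive (sym (⟦⟧-yes Q? (f p)))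

⟦⟧-cong : (P? : Dec P) (Q? : Dec Q) → (P → Q) → (Q → P) → ⟦ P? ⟧ ≡ ⟦ Q? ⟧
⟦⟧-cong P? Q? f g = ℕ.≤-antisym (⟦⟧-mono P? Q? f) (⟦⟧-mono Q? P? g)

∑ : List I → (I → ℕ) → ℕ
∑ xs f = sum (map f xs)

∑-cong : ∀ (xs : List I) {f g : I → ℕ} → (∀ x → f x ≡ g x) → ∑ xs f ≡ ∑ xs g
∑-cong xs eq = cong sum (map-cong eq xs)

∑-mono : ∀ (xs : List I) {f g : I → ℕ} → (∀ {x} → x ∈ₗ xs → f x ≤ g x) → ∑ xs f ≤ ∑ xs g
∑-mono []       le = z≤n
∑-mono (x ∷ xs) le = ℕ.+-mono-≤ (le (here refl)) (∑-mono xs (le ∘ there))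

∑-+ : ∀ (xs : List I) (f g : I → ℕ) → ∑ xs (λ x → f x + g x) ≡ ∑ xs f + ∑ xs g
∑-+ []       f g = refl
∑-+ (x ∷ xs) f g rewrite ∑-+ xs f g = interchange (f x) (g x) (∑ xs f) (∑ xs g)
  where
  interchange : ∀ a b c d → a + b + (c + d) ≡ a + c + (b + d)
  interchange = solve-∀

∑-*ˡ : ∀ (xs : List I) k (f : I → ℕ) → ∑ xs (λ x → k * f x) ≡ k * ∑ xs f
∑-*ˡ []       k f = sym (ℕ.*-zeroʳ k)
∑-*ˡ (x ∷ xs) k f rewrite ∑-*ˡ xs k f = sym (ℕ.*-distribˡ-+ k (f x) (∑ xs f))

∑-const : ∀ (xs : List I) k → ∑ xs (λ _ → k) ≡ length xs * k
∑-const []       k = refl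
∑-const (x ∷ xs) k = cong (k +_) (∑-const xs k)

∑-zero : ∀ (xs : List I) {f : I → ℕ} → (∀ {x} → x ∈ₗ xs → f x ≡ 0) → ∑ xs f ≡ 0
∑-zero []       eq = refl
∑-zero (x ∷ xs) eq rewrite eq (here refl) = ∑-zero xs (eq ∘ there)

∑-swap : ∀ (xs : List I) (ys : List K) (g : I → K → ℕ) →
  ∑ xs (λ x → ∑ ys (g x)) ≡ ∑ ys (λ y → ∑ xs (λ x → g x y))
∑-swap []       ys g = sym (∑-zero ys (λ _ → refl))
∑-swap (x ∷ xs) ys g rewrite ∑-swap xs ys g =
  sym (∑-+ ys (g x) (λ y → ∑ xs (λ x → g x y)))

f≤∑ : ∀ {xs : List I} (f : I → ℕ) {x} → x ∈ₗ xs → f x ≤ ∑ xs f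
f≤∑ f (here refl) = ℕ.m≤m+n _ _
f≤∑ f (there x∈)  = ℕ.m≤n⇒m≤o+n _ (f≤∑ f x∈)

∑≢0 : ∀ (xs : List I) (f : I → ℕ) → ∑ xs f ≢ 0 → ∃[ x ] x ∈ₗ xs × f x ≢ 0
∑≢0 []       f ≢0 = contradiction refl ≢0
∑≢0 (x ∷ xs) f ≢0 with f x in eq
... | suc _ = x , here refl , λ fx≡0 → ℕ.1+n≢0 (trans (sym eq) fx≡0)
... | zero  with y , y∈ , fy≢0 ← ∑≢0 xs f ≢0 = y , there y∈ , fy≢0

∑-filter : ∀ {P : I → Set} (P? : Decidable P) xs (f : I → ℕ) →
  ∑ (filter P? xs) f ≡ ∑ xs (λ x → f x * ⟦ P? x ⟧)
∑-filter P? []       f = refl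
∑-filter P? (x ∷ xs) f with P? x
... | yes _ = cong₂ _+_ (sym (ℕ.*-identityʳ (f x))) (∑-filter P? xs f)
... | no  _ rewrite ℕ.*-zeroʳ (f x) = ∑-filter P? xs f

∑-delta : ∀ {n} {xs : List (Fin n)} {x} → Unique xs → x ∈ₗ xs → (f : Fin n → ℕ) →
  ∑ xs (λ y → f y * ⟦ y ≟ x ⟧) ≡ f x
∑-delta {xs = x ∷ xs} (x∉ ∷ _) (here refl) f
  rewrite ⟦⟧-yes (x ≟ x) refl
        | ∑-zero xs {λ y → f y * ⟦ y ≟ x ⟧} (λ {y} y∈ →
            trans (cong (f y *_) (⟦⟧-no (y ≟ x) λ y≡x → All.lookup x∉ y∈ (sym y≡x))) (ℕ.*-zeroʳ (f y)))
        = trans (ℕ.+-identityʳ _) (ℕ.*-identityʳ _)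
∑-delta {xs = y ∷ xs} {x} (y∉ ∷ u) (there x∈) f
  rewrite ⟦⟧-no (y ≟ x) (All.lookup y∉ x∈) | ℕ.*-zeroʳ (f y) = ∑-delta u x∈ f

-- Paths

module Paths {D : Digraph} (H : Subgraph D) where
  open Digraph D using (src; tgt)
  open Subgraph H

  src-vertex : ∀ {u v} p → IsPath H u v p → u ∈ vertices
  src-vertex []      (_ , u∈)          = u∈
  src-vertex (e ∷ p) (e∈ , refl , _)   = src∈ e∈

  tgt-vertex : ∀ {u v} p → IsPath H u v p → v ∈ vertices
  tgt-vertex []      (refl , u∈)   = u∈
  tgt-vertex (e ∷ p) (_ , _ , path) = tgt-vertex p path

  single : ∀ {e} → e ∈ edges → IsPath H (src e) (tgt e) (e ∷ [])
  single e∈ = e∈ , refl , refl , tgt∈ e∈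

  concat : ∀ {u v w} p {q} → IsPath H u v p → IsPath H v w q → IsPath H u w (p ++ q)
  concat []      (refl , _)         path = path
  concat (e ∷ p) (e∈ , refl , rest) path = e∈ , refl , concat p rest path

  split : ∀ {u w} p {q} → IsPath H u w (p ++ q) → ∃[ v ] IsPath H u v p × IsPath H v w q
  split []      {q} path = _ , (refl , src-vertex q path) , path
  split (e ∷ p) (e∈ , refl , path) with v , path₁ , path₂ ← split p path =
    v , (e∈ , refl , path₁) , path₂

  split-∈ : ∀ {u v e p} → IsPath H u v p → e ∈ₗ p →
    ∃[ q ] ∃[ r ] p ≡ q ++ e ∷ r × IsPath H u (src e) q × IsPath H (tgt e) v r
  split-∈ path e∈p with q , r , refl ← ∈-∃++ e∈p
    with _ , path₁ , (_ , refl , path₂) ← split q path = q , r , refl , path₁ , path₂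

  snoc : ∀ {u v e} p → IsPath H u v p → e ∈ edges → src e ≡ v → IsPath H u (tgt e) (p ∷ʳ e)
  snoc p path e∈ refl = concat p path (single e∈)

  unsnoc : ∀ {u v e} p → IsPath H u v (p ∷ʳ e) → IsPath H u (src e) p × tgt e ≡ v × e ∈ edges
  unsnoc p path with _ , path₁ , (e∈ , refl , (tgt≡ , _)) ← split p path = path₁ , tgt≡ , e∈

  end-unique : ∀ {u v w} p → IsPath H u v p → IsPath H u w p → v ≡ w
  end-unique []      (u≡v , _)     (u≡w , _)      = trans (sym u≡v) u≡w
  end-unique (e ∷ p) (_ , _ , path) (_ , _ , path′) = end-unique p path path′

  edges-in : ∀ {u v} p → IsPath H u v p → All (_∈ edges) p
  edges-in []      _               = []
  edges-in (e ∷ p) (e∈ , _ , path) = e∈ ∷ edges-in p path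

  -- The vertex hypothesis serves the empty path; after an edge, `tgt∈` supplies it for the rest.
  move : ∀ (H′ : Subgraph D) {u v} p → IsPath H u v p →
    All (_∈ Subgraph.edges H′) p → u ∈ Subgraph.vertices H′ → IsPath H′ u v p
  move H′ []      (u≡v , _)        _          u∈ = u≡v , u∈
  move H′ (e ∷ p) (_ , src≡ , path) (e∈ ∷ p⊆) u∈ =
    e∈ , src≡ , move H′ p path p⊆ (Subgraph.tgt∈ H′ e∈)

∈-comprehension⁺ : ∀ {n} {P : Fin n → Set} (P? : Decidable P) {x} → P x → x ∈ tabulate (does ∘ P?)
∈-comprehension⁺ P? {x} Px = lookup⇒[]= x _ (trans (lookup∘tabulate _ x) (dec-true (P? x) Px))

∈-comprehension⁻ : ∀ {n} {P : Fin n → Set} (P? : Decidable P) {x} → x ∈ tabulate (does ∘ P?) → P x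
∈-comprehension⁻ P? {x} x∈ with P? x | trans (sym (lookup∘tabulate (does ∘ P?) x)) ([]=⇒lookup x∈)
... | yes Px | _ = Px

two-elements : ∀ {A : Set} {xs : List A} {x y} → x ∈ₗ xs → y ∈ₗ xs → x ≢ y → 1 < length xs
two-elements (here refl) (here refl)         x≢y = contradiction refl x≢y
two-elements {xs = _ ∷ _ ∷ _} (here _) (there _)   _ = s≤s (s≤s z≤n)
two-elements {xs = _ ∷ _ ∷ _} (there _) _          _ = s≤s (s≤s z≤n)

distinct-elements : ∀ {A : Set} {xs : List A} → Unique xs → 1 < length xs →
  ∃[ x ] ∃[ y ] x ∈ₗ xs × y ∈ₗ xs × x ≢ y
distinct-elements ((x≢y ∷ _) ∷ _) (s≤s (s≤s _)) = _ , _ , here refl , there (here refl) , x≢y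

module _ {D : Digraph} (H : Subgraph D) where
  open Digraph D using (src; tgt)
  open Subgraph H

  merging⁺ : ∀ {e f v} → e ∈ edges → f ∈ edges → tgt e ≡ v → tgt f ≡ v → e ≢ f → IsMerging H v
  merging⁺ e∈ f∈ e→v f→v = two-elements (∈-filter⁺ _ (∈-allFin _) (e∈ , e→v))
                                         (∈-filter⁺ _ (∈-allFin _) (f∈ , f→v))

  forking⁺ : ∀ {e f v} → e ∈ edges → f ∈ edges → src e ≡ v → src f ≡ v → e ≢ f → IsForking H v
  forking⁺ e∈ f∈ v→e v→f = two-elements (∈-filter⁺ _ (∈-allFin _) (e∈ , v→e))
                                         (∈-filter⁺ _ (∈-allFin _) (f∈ , v→f))

  merging⁻ : ∀ {v} → IsMerging H v →
    ∃[ e ] ∃[ f ] e ∈ edges × f ∈ edges × tgt e ≡ v × tgt f ≡ v × e ≢ f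
  merging⁻ {v} merging
    with e , f , e∈ , f∈ , e≢f ← distinct-elements (filter⁺ _ (allFin⁺ _)) merging
    with _ , e∈H , e→v ← ∈-filter⁻ (λ e → (e ∈? edges) ×-dec (tgt e ≟ v)) {xs = allFin _} e∈
       | _ , f∈H , f→v ← ∈-filter⁻ (λ e → (e ∈? edges) ×-dec (tgt e ≟ v)) {xs = allFin _} f∈
       = e , f , e∈H , f∈H , e→v , f→v , e≢f

  forking⁻ : ∀ {v} → IsForking H v →
    ∃[ e ] ∃[ f ] e ∈ edges × f ∈ edges × src e ≡ v × src f ≡ v × e ≢ f
  forking⁻ {v} forking
    with e , f , e∈ , f∈ , e≢f ← distinct-elements (filter⁺ _ (allFin⁺ _)) forking
    with _ , e∈H , v→e ← ∈-filter⁻ (λ e → (e ∈? edges) ×-dec (src e ≟ v)) {xs = allFin _} e∈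
       | _ , f∈H , v→f ← ∈-filter⁻ (λ e → (e ∈? edges) ×-dec (src e ≟ v)) {xs = allFin _} f∈
       = e , f , e∈H , f∈H , v→e , v→f , e≢f

-- Well-founded induction along the edges

module Acyclic (G : STDAG) where
  open STDAG G
  open IsSTDAG isSTDAG
  open Paths full

  Path : V digraph → V digraph → List (E digraph) → Set
  Path = IsPath full

  -- Reachability by a nonempty path. Acyclicity makes it a strict partial order, and on finitely
  -- many vertices it is well-founded in both directions.
  _⊏_ : V digraph → V digraph → Set
  u ⊏ v = ∃[ e ] ∃[ p ] Path u v (e ∷ p)

  ⊏-irrefl : ∀ {v} → ¬ v ⊏ v
  ⊏-irrefl (e , p , path) with () ← acyclic {p = e ∷ p} path

  edge-⊏ : ∀ e → src e ⊏ tgt e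
  edge-⊏ e = e , [] , single ∈⊤

  ⊏-isStrictPartialOrder : IsStrictPartialOrder _≡_ _⊏_
  ⊏-isStrictPartialOrder = record
    { isEquivalence = isEquivalence
    ; irrefl        = λ { refl → ⊏-irrefl }
    ; trans         = λ { (e , p , path) (f , q , path′) →
                          e , p ++ f ∷ q , concat (e ∷ p) path path′ }
    ; <-resp-≈      = (λ { refl → id }) , (λ { refl → id })
    }

  abstract
    ⊏-wellFounded : WellFounded _⊏_
    ⊏-wellFounded = spo-wellFounded ⊏-isStrictPartialOrder

    ⊏-noetherian : WellFounded (flip _⊏_)
    ⊏-noetherian = spo-noetherian ⊏-isStrictPartialOrder

  no-cycle : ∀ {e} p → ¬ Path (tgt e) (src e) p
  no-cycle {e} p path = ⊏-irrefl (e , p , ∈⊤ , refl , path)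

  no-in-edge : ∀ {e} → tgt e ≢ s
  no-in-edge = proj₂ source ∈⊤

  no-out-edge : ∀ {e} → src e ≢ t
  no-out-edge = proj₂ sink ∈⊤

  edge-on-path-unique : ∀ {u v} p → Path u v p → Unique p
  edge-on-path-unique []      _               = []
  edge-on-path-unique (e ∷ p) (_ , refl , path) =
    ¬Any⇒All¬ p (λ e∈p → let q , _ , _ , path₁ , _ = split-∈ path e∈p in no-cycle q path₁)
    ∷ edge-on-path-unique p path

  module _ {P : V digraph → Set} {Q : E digraph → Set} (r : V digraph) where

    -- A walk backwards inside `P` along edges of `Q` terminates by well-foundedness, and `r` is the
    -- only vertex at which it can stop.
    backward-walk : (∀ {v} → P v → v ≢ r → ∃[ e ] Q e × P (src e) × tgt e ≡ v) →
      ∀ {v} → P v → ∃[ p ] Path r v p × All Q p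
    backward-walk step {v} = go (⊏-wellFounded v)
      where
      go : ∀ {v} → Acc _⊏_ v → P v → ∃[ p ] Path r v p × All Q p
      go {v} (acc rs) Pv with v ≟ r
      ... | yes refl = [] , (refl , ∈⊤) , []
      ... | no  v≢r
        with e , Qe , Psrc , refl ← step Pv v≢r
        with p , path , p⊆ ← go (rs (edge-⊏ e)) Psrc
           = p ∷ʳ e , snoc p path ∈⊤ refl , ∷ʳ⁺ p⊆ Qe

    forward-walk : (∀ {v} → P v → v ≢ r → ∃[ e ] Q e × P (tgt e) × src e ≡ v) →
      ∀ {v} → P v → ∃[ p ] Path v r p × All Q p
    forward-walk step {v} = go (⊏-noetherian v)
      where
      go : ∀ {v} → Acc (flip _⊏_) v → P v → ∃[ p ] Path v r p × All Q p
      go {v} (acc rs) Pv with v ≟ r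
      ... | yes refl = [] , (refl , ∈⊤) , []
      ... | no  v≢r
        with e , Qe , Ptgt , refl ← step Pv v≢r
        with p , path , p⊆ ← go (rs (edge-⊏ e)) Ptgt
           = e ∷ p , (∈⊤ , refl , path) , Qe ∷ p⊆

  path-in-full : ∀ (H : Subgraph digraph) {u v} p → IsPath H u v p → Path u v p
  path-in-full H p path = Paths.move H full p path (All.map (λ _ → ∈⊤) (Paths.edges-in H p path)) ∈⊤

  module _ (H : Subgraph digraph) {s′ t′ : V digraph} (H-isSTDAG : IsSTDAG H s′ t′) where
    private
      module H = Subgraph H
      module ST = IsSTDAG H-isSTDAG

    -- A vertex of `H` other than `s′` is not a source of `H`, so it has an in-edge in `H` and the
    -- walk back continues.
    from-source : ∀ {v} → v ∈ H.vertices → ∃[ p ] IsPath H s′ v p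
    from-source v∈ =
      let p , path , p⊆ = backward-walk {P = _∈ H.vertices} s′ step v∈
      in p , move H p path p⊆ (proj₁ ST.source)
      where
      step : ∀ {v} → v ∈ H.vertices → v ≢ s′ → ∃[ e ] e ∈ H.edges × src e ∈ H.vertices × tgt e ≡ v
      step {v} v∈ v≢s′ with any? (λ e → (e ∈? H.edges) ×-dec (tgt e ≟ v))
      ... | yes (e , e∈ , eq) = e , e∈ , H.src∈ e∈ , eq
      ... | no  none = contradiction
        (ST.source-unique (v∈ , λ {e} e∈ eq → none (e , e∈ , eq))) v≢s′

    to-sink : ∀ {v} → v ∈ H.vertices → ∃[ p ] IsPath H v t′ p
    to-sink v∈ =
      let p , path , p⊆ = forward-walk {P = _∈ H.vertices} t′ step v∈
      in p , move H p path p⊆ v∈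
      where
      step : ∀ {v} → v ∈ H.vertices → v ≢ t′ → ∃[ e ] e ∈ H.edges × tgt e ∈ H.vertices × src e ≡ v
      step {v} v∈ v≢t′ with any? (λ e → (e ∈? H.edges) ×-dec (src e ≟ v))
      ... | yes (e , e∈ , eq) = e , e∈ , H.tgt∈ e∈ , eq
      ... | no  none = contradiction
        (ST.sink-unique (v∈ , λ {e} e∈ eq → none (e , e∈ , eq))) v≢t′

  -- Reachability in the graph of the edges satisfying `Q`. Using a predicate lets `Q` vary without
  -- building a subgraph each time.
  Reach : (E digraph → Set) → V digraph → V digraph → Set
  Reach Q u v = ∃[ p ] Path u v p × All Q p

  reach-refl : ∀ {Q v} → Reach Q v v
  reach-refl = [] , (refl , ∈⊤) , []

  reach-step : ∀ {Q e v} → Q e → Reach Q (tgt e) v → Reach Q (src e) v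
  reach-step {e = e} Qe (p , path , p⊆) = e ∷ p , (∈⊤ , refl , path) , Qe ∷ p⊆

  reach-snoc : ∀ {Q e u} → Reach Q u (src e) → Q e → Reach Q u (tgt e)
  reach-snoc {e = e} (p , path , p⊆) Qe = p ∷ʳ e , snoc p path ∈⊤ refl , ∷ʳ⁺ p⊆ Qe

  reach-trans : ∀ {Q u v w} → Reach Q u v → Reach Q v w → Reach Q u w
  reach-trans (p , path , p⊆) (q , path′ , q⊆) = p ++ q , concat p path path′ , ++⁺ p⊆ q⊆

  reach-first : ∀ {Q u v} → Reach Q u v → u ≡ v ⊎ ∃[ e ] Q e × src e ≡ u × Reach Q (tgt e) v
  reach-first ([]    , (u≡v , _)        , _)       = inj₁ u≡v
  reach-first (e ∷ p , (_ , src≡ , path) , Qe ∷ p⊆) = inj₂ (e , Qe , src≡ , p , path , p⊆)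

  reach-last : ∀ {Q u v} → Reach Q u v → u ≡ v ⊎ ∃[ e ] Q e × tgt e ≡ v × Reach Q u (src e)
  reach-last ([] , (u≡v , _) , _) = inj₁ u≡v
  reach-last (e ∷ p , (_ , refl , path) , Qe ∷ p⊆) with reach-last (p , path , p⊆)
  ... | inj₁ refl                  = inj₂ (e , Qe , refl , reach-refl)
  ... | inj₂ (f , Qf , tgt≡ , r) = inj₂ (f , Qf , tgt≡ , reach-step Qe r)

  crossing : ∀ {P : V digraph → Set} {Q u v} → Decidable P → P u → ¬ P v → Reach Q u v →
    ∃[ e ] Q e × P (src e) × ¬ P (tgt e) × Reach Q u (src e) × Reach Q (tgt e) v
  crossing {P} {Q} {v = v} P? Pu ¬Pv (p , path , p⊆) = go p path p⊆ Pu
    where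
    go : ∀ {u} p → Path u v p → All Q p → P u →
      ∃[ e ] Q e × P (src e) × ¬ P (tgt e) × Reach Q u (src e) × Reach Q (tgt e) v
    go []      (refl , _)        []         Pu = contradiction Pu ¬Pv
    go (e ∷ p) (_ , refl , path) (Qe ∷ p⊆) Pu with P? (tgt e)
    ... | no ¬Ptgt = e , Qe , Pu , ¬Ptgt , reach-refl , (p , path , p⊆)
    ... | yes Ptgt with f , Qf , Psrc , ¬Ptgt , r , r′ ← go p path p⊆ Ptgt =
      f , Qf , Psrc , ¬Ptgt , reach-step Qe r , r′

  -- Reduces lying on a common path to reachability. Both lower bounds on width use it to exclude
  -- two representatives on one path.
  order : ∀ {Q u v q e f} → Path u v q → All Q q → e ∈ₗ q → f ∈ₗ q →
    e ≡ f ⊎ Reach Q (tgt e) (src f) ⊎ Reach Q (tgt f) (src e)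
  order {q = _ ∷ _} _                 _        (here refl)  (here refl)  = inj₁ refl
  order {q = _ ∷ _} (_ , _ , path)    (_ ∷ q⊆) (there e∈)   (there f∈)   = order path q⊆ e∈ f∈
  order {q = _ ∷ q} (_ , _ , path)    (_ ∷ q⊆) (here refl)  (there f∈)
    with r , _ , refl , path′ , _ ← split-∈ path f∈ = inj₂ (inj₁ (r , path′ , proj₁ (++⁻ r q⊆)))
  order {q = _ ∷ q} (_ , _ , path)    (_ ∷ q⊆) (there e∈)   (here refl)
    with r , _ , refl , path′ , _ ← split-∈ path e∈ = inj₂ (inj₂ (r , path′ , proj₁ (++⁻ r q⊆)))

  reach? : ∀ {Q} → Decidable Q → ∀ u v → Dec (Reach Q u v)
  reach? {Q} Q? u v = go (⊏-noetherian u)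
    where
    go : ∀ {u} → Acc (flip _⊏_) u → Dec (Reach Q u v)
    go {u} (acc rs) with u ≟ v
    ... | yes refl = yes reach-refl
    ... | no  u≢v  = map′ join unjoin (any? step?)
      where
      Step : E digraph → Set
      Step e = src e ≡ u × Q e × Reach Q (tgt e) v

      step? : Decidable Step
      -- The recursive call is available only at successors of `u`, so `src e ≡ u` has to be decided
      -- first.
      step? e with src e ≟ u
      ... | no  src≢ = no (src≢ ∘ proj₁)
      ... | yes refl = map′ (refl ,_) proj₂ (Q? e ×-dec go (rs (edge-⊏ e)))

      join : ∃[ e ] Step e → Reach Q u v
      join (e , refl , Qe , r) = reach-step Qe r

      unjoin : Reach Q u v → ∃[ e ] Step e
      unjoin r with reach-first r
      ... | inj₁ u≡v = contradiction u≡v u≢v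
      ... | inj₂ (e , Qe , src≡ , r′) = e , src≡ , Qe , r′

-- Flows and cuts

module Flows (G : STDAG) where
  open STDAG G
  open Paths full
  open Acyclic G
  open Flow

  inflow outflow : (E digraph → ℕ) → V digraph → ℕ
  inflow  f v = ∑ (inEdges full v) f
  outflow f v = ∑ (outEdges full v) f

  inflow-formula : ∀ f v → inflow f v ≡ ∑ (allFin _) (λ e → f e * ⟦ v ≟ tgt e ⟧)
  inflow-formula f v = trans (∑-filter _ (allFin _) f)
    (∑-cong (allFin _) λ e → cong (f e *_)
      (⟦⟧-cong ((e ∈? ⊤) ×-dec (tgt e ≟ v)) (v ≟ tgt e) (sym ∘ proj₂) λ eq → ∈⊤ , sym eq))

  outflow-formula : ∀ f v → outflow f v ≡ ∑ (allFin _) (λ e → f e * ⟦ v ≟ src e ⟧)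
  outflow-formula f v = trans (∑-filter _ (allFin _) f)
    (∑-cong (allFin _) λ e → cong (f e *_)
      (⟦⟧-cong ((e ∈? ⊤) ×-dec (src e ≟ v)) (v ≟ src e) (sym ∘ proj₂) λ eq → ∈⊤ , sym eq))

  in-edge : ∀ {f v} → inflow f v ≢ 0 → ∃[ e ] f e ≢ 0 × tgt e ≡ v
  in-edge {f} {v} ≢0 with e , e∈ , fe≢0 ← ∑≢0 (inEdges full v) f ≢0
    with _ , _ , eq ← ∈-filter⁻ (λ e → (e ∈? ⊤) ×-dec (tgt e ≟ v)) {xs = allFin _} e∈ = e , fe≢0 , eq

  out-edge : ∀ {f v} → outflow f v ≢ 0 → ∃[ e ] f e ≢ 0 × src e ≡ v
  out-edge {f} {v} ≢0 with e , e∈ , fe≢0 ← ∑≢0 (outEdges full v) f ≢0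
    with _ , _ , eq ← ∈-filter⁻ (λ e → (e ∈? ⊤) ×-dec (src e ≟ v)) {xs = allFin _} e∈ = e , fe≢0 , eq

  f≤inflow : ∀ f e → f e ≤ inflow f (tgt e)
  f≤inflow f e = f≤∑ f (∈-filter⁺ _ (∈-allFin e) (∈⊤ , refl))

  f≤outflow : ∀ f e → f e ≤ outflow f (src e)
  f≤outflow f e = f≤∑ f (∈-filter⁺ _ (∈-allFin e) (∈⊤ , refl))

  inflow-s : ∀ f → inflow f s ≡ 0
  inflow-s f with inflow f s in eq
  ... | zero  = refl
  ... | suc n with _ , _ , into-s ← in-edge {f} {s} (λ ≡0 → ℕ.1+n≢0 (trans (sym eq) ≡0)) =
    contradiction into-s no-in-edge

  -- The multiplicity of an edge in `p`; as a function of the edge, the unit flow along `p`.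
  count : List (E digraph) → E digraph → ℕ
  count p e = ∑ p (λ x → ⟦ e ≟ x ⟧)

  count≢0⁺ : ∀ {e p} → e ∈ₗ p → count p e ≢ 0
  count≢0⁺ {e} {p} e∈p ≡0 = ℕ.<⇒≱ (s≤s z≤n)
    (ℕ.≤-trans (ℕ.≤-reflexive (sym (⟦⟧-yes (e ≟ e) refl)))
               (ℕ.≤-trans (f≤∑ (λ x → ⟦ e ≟ x ⟧) e∈p) (ℕ.≤-reflexive ≡0)))

  count≢0⁻ : ∀ {e} p → count p e ≢ 0 → e ∈ₗ p
  count≢0⁻ {e} p ≢0 with x , x∈ , ≢0′ ← ∑≢0 p (λ x → ⟦ e ≟ x ⟧) ≢0 with e ≟ x
  ... | yes refl = x∈
  ... | no  _    = contradiction refl ≢0′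

  count≤1 : ∀ {p} e → Unique p → count p e ≤ 1
  count≤1         e []         = z≤n
  count≤1 {x ∷ p} e (x∉ ∷ u) with e ≟ x
  ... | no  _    = count≤1 e u
  ... | yes refl = ℕ.≤-reflexive (cong suc (∑-zero p λ {y} y∈ → ⟦⟧-no (e ≟ y) (All.lookup x∉ y∈)))

  inflow-count : ∀ p v → inflow (count p) v ≡ ∑ p (λ x → ⟦ v ≟ tgt x ⟧)
  inflow-count p v = trans (∑-swap (inEdges full v) p (λ e x → ⟦ e ≟ x ⟧))
    (∑-cong p λ x → trans (inflow-formula (λ e → ⟦ e ≟ x ⟧) v)
      (trans (∑-cong (allFin _) λ e → ℕ.*-comm ⟦ e ≟ x ⟧ _) 
        (∑-delta (allFin⁺ _) (∈-allFin x) (λ e → ⟦ v ≟ tgt e ⟧))))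

  outflow-count : ∀ p v → outflow (count p) v ≡ ∑ p (λ x → ⟦ v ≟ src x ⟧)
  outflow-count p v = trans (∑-swap (outEdges full v) p (λ e x → ⟦ e ≟ x ⟧))
    (∑-cong p λ x → trans (outflow-formula (λ e → ⟦ e ≟ x ⟧) v)
      (trans (∑-cong (allFin _) λ e → ℕ.*-comm ⟦ e ≟ x ⟧ _) 
        (∑-delta (allFin⁺ _) (∈-allFin x) (λ e → ⟦ v ≟ src e ⟧))))

  -- Telescoping: the head of each edge of the path is the tail of the next, so only the two ends
  -- stay unmatched. Each end is added on the side that avoids subtraction. Inner vertices give
  -- conservation, and `v = s` gives the value.
  path-balance : ∀ {u w} p v → Path u w p →
    inflow (count p) v + ⟦ v ≟ u ⟧ ≡ outflow (count p) v + ⟦ v ≟ w ⟧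
  path-balance {u} {w} p v path rewrite inflow-count p v | outflow-count p v = go p path
    where
    go : ∀ {u} p → Path u w p →
      ∑ p (λ x → ⟦ v ≟ tgt x ⟧) + ⟦ v ≟ u ⟧ ≡ ∑ p (λ x → ⟦ v ≟ src x ⟧) + ⟦ v ≟ w ⟧
    go []      (refl , _) = refl
    go (e ∷ p) (_ , refl , path) = begin
      ⟦ v ≟ tgt e ⟧ + ∑ p _ + ⟦ v ≟ src e ⟧   ≡⟨ cong (_+ ⟦ v ≟ src e ⟧) (ℕ.+-comm ⟦ v ≟ tgt e ⟧ _) ⟩
      ∑ p _ + ⟦ v ≟ tgt e ⟧ + ⟦ v ≟ src e ⟧   ≡⟨ cong (_+ ⟦ v ≟ src e ⟧) (go p path) ⟩
      ∑ p _ + ⟦ v ≟ w ⟧ + ⟦ v ≟ src e ⟧       ≡⟨ ℕ.+-comm _ ⟦ v ≟ src e ⟧ ⟩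
      ⟦ v ≟ src e ⟧ + (∑ p _ + ⟦ v ≟ w ⟧)     ≡⟨ ℕ.+-assoc ⟦ v ≟ src e ⟧ _ _ ⟨
      ⟦ v ≟ src e ⟧ + ∑ p _ + ⟦ v ≟ w ⟧       ∎
      where open ≡-Reasoning

  path-conserve : ∀ {p} → Path s t p → ∀ v → v ≢ s → v ≢ t → inflow (count p) v ≡ outflow (count p) v
  path-conserve {p} path v v≢s v≢t =
    trans (sym (ℕ.+-identityʳ _)) (trans balance (ℕ.+-identityʳ _))
    where
    balance : inflow (count p) v + 0 ≡ outflow (count p) v + 0
    balance = subst₂ (λ a b → inflow (count p) v + a ≡ outflow (count p) v + b)
                (⟦⟧-no (v ≟ s) v≢s) (⟦⟧-no (v ≟ t) v≢t) (path-balance p v path)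

  path-value : s ≢ t → ∀ {p} → Path s t p → outflow (count p) s ≡ 1
  path-value s≢t {p} path = sym (trans balance (ℕ.+-identityʳ _))
    where
    balance : 1 ≡ outflow (count p) s + 0
    balance = subst₂ (λ a b → a ≡ outflow (count p) s + b)
      (cong₂ _+_ (inflow-s (count p)) (⟦⟧-yes (s ≟ s) refl)) (⟦⟧-no (s ≟ t) s≢t) (path-balance p s path)

  pathsFlow : ∀ {ps} → All (Path s t) ps → Flow G
  pathsFlow {ps} paths = record
    { on       = λ e → ∑ ps (λ p → count p e)
    ; conserve = λ v v≢s v≢t → trans (∑-swap (inEdges full v) ps (flip count))
        (trans (conserve-all paths v v≢s v≢t) (sym (∑-swap (outEdges full v) ps (flip count))))
    }
    where
    conserve-all : ∀ {ps} → All (Path s t) ps → ∀ v → v ≢ s → v ≢ t →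
      ∑ ps (λ p → inflow (count p) v) ≡ ∑ ps (λ p → outflow (count p) v)
    conserve-all []             v v≢s v≢t = refl
    conserve-all (path ∷ paths) v v≢s v≢t =
      cong₂ _+_ (path-conserve path v v≢s v≢t) (conserve-all paths v v≢s v≢t)

  pathsFlow-value : s ≢ t → ∀ {ps} (paths : All (Path s t) ps) → ∣ pathsFlow paths ∣ ≡ length ps
  pathsFlow-value s≢t {ps} paths = trans (∑-swap (outEdges full s) ps (flip count)) (go paths)
    where
    go : ∀ {ps} → All (Path s t) ps → ∑ ps (λ p → outflow (count p) s) ≡ length ps
    go []             = refl
    go (path ∷ paths) = cong₂ _+_ (path-value s≢t path) (go paths)

  pathsFlow≢0⁺ : ∀ {ps} (paths : All (Path s t) ps) {e} → Any (e ∈ₗ_) ps → on (pathsFlow paths) e ≢ 0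
  pathsFlow≢0⁺ {ps} paths {e} e∈ ≡0 =
    let p , p∈ , e∈p = find e∈
    in count≢0⁺ e∈p (ℕ.n≤0⇒n≡0 (ℕ.≤-trans (f≤∑ (λ p → count p e) p∈) (ℕ.≤-reflexive ≡0)))

  pathsFlow≢0⁻ : ∀ {ps} (paths : All (Path s t) ps) {e} → on (pathsFlow paths) e ≢ 0 → Any (e ∈ₗ_) ps
  pathsFlow≢0⁻ {ps} paths {e} ≢0 with p , p∈ , ≢0′ ← ∑≢0 ps (λ p → count p e) ≢0 =
    Any.map (λ { refl → count≢0⁻ p ≢0′ }) p∈

  support⁺ : ∀ (X : Flow G) {e} → on X e ≢ 0 → e ∈ Subgraph.edges (support X)
  support⁺ X = ∈-comprehension⁺ (λ e → ¬? (on X e ℕ.≟ 0))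

  support⁻ : ∀ (X : Flow G) {e} → e ∈ Subgraph.edges (support X) → on X e ≢ 0
  support⁻ X = ∈-comprehension⁻ (λ e → ¬? (on X e ℕ.≟ 0))

  support-path⁺ : ∀ (X : Flow G) {u v} p → Path u v p → All (λ e → on X e ≢ 0) p →
    IsPath (support X) u v p
  support-path⁺ X p path p⊆ = move (support X) p path (All.map (support⁺ X) p⊆) ∈⊤

  support-path⁻ : ∀ (X : Flow G) {u v} p → IsPath (support X) u v p →
    Path u v p × All (λ e → on X e ≢ 0) p
  support-path⁻ X p path =
    path-in-full (support X) p path , All.map (support⁻ X) (Paths.edges-in (support X) p path)

  module _ (X : Flow G) where
    private
      X≢0 : E digraph → Set
      X≢0 e = on X e ≢ 0

    -- By conservation, a vertex other than `s` with a non-zero out-edge also has a non-zero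
    -- in-edge, so walking back along non-zero edges stops only at `s`.
    reach-from-s : ∀ {e} → X≢0 e → Reach X≢0 s (src e)
    reach-from-s {e} Xe≢0 = backward-walk {P = λ v → ∃[ e ] X≢0 e × src e ≡ v} s step (e , Xe≢0 , refl)
      where
      step : ∀ {v} → ∃[ e ] X≢0 e × src e ≡ v → v ≢ s →
        ∃[ e ] X≢0 e × (∃[ f ] X≢0 f × src f ≡ src e) × tgt e ≡ v
      step (e , Xe≢0 , refl) v≢s
        with f , Xf≢0 , eq ← in-edge (λ in≡0 → Xe≢0 (ℕ.n≤0⇒n≡0 (ℕ.≤-trans (f≤outflow (on X) e)
               (ℕ.≤-reflexive (trans (sym (conserve X _ v≢s no-out-edge)) in≡0)))))
           = f , Xf≢0 , (f , Xf≢0 , refl) , eq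

    reach-to-t : ∀ {e} → X≢0 e → Reach X≢0 (tgt e) t
    reach-to-t {e} Xe≢0 = forward-walk {P = λ v → ∃[ e ] X≢0 e × tgt e ≡ v} t step (e , Xe≢0 , refl)
      where
      step : ∀ {v} → ∃[ e ] X≢0 e × tgt e ≡ v → v ≢ t →
        ∃[ e ] X≢0 e × (∃[ f ] X≢0 f × tgt f ≡ tgt e) × src e ≡ v
      step (e , Xe≢0 , refl) v≢t
        with f , Xf≢0 , eq ← out-edge (λ out≡0 → Xe≢0 (ℕ.n≤0⇒n≡0 (ℕ.≤-trans (f≤inflow (on X) e)
               (ℕ.≤-reflexive (trans (conserve X _ no-in-edge v≢t) out≡0)))))
           = f , Xf≢0 , (f , Xf≢0 , refl) , eq

    value≢0 : IsNonZero X → ∣ X ∣ ≢ 0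
    value≢0 (e , Xe≢0) ∣X∣≡0 with reach-first (reach-snoc (reach-from-s Xe≢0) Xe≢0)
    ... | inj₁ s≡tgt                 = no-in-edge (sym s≡tgt)
    ... | inj₂ (f , Xf≢0 , refl , _) =
      Xf≢0 (ℕ.n≤0⇒n≡0 (ℕ.≤-trans (f≤outflow (on X) f) (ℕ.≤-reflexive ∣X∣≡0)))

    nonzero⇒s≢t : IsNonZero X → s ≢ t
    nonzero⇒s≢t (e , Xe≢0) s≡t with reach-first (reach-snoc (reach-from-s Xe≢0) Xe≢0)
    ... | inj₁ s≡tgt               = no-in-edge (sym s≡tgt)
    ... | inj₂ (f , _ , src≡s , _) = no-out-edge (trans src≡s s≡t)

  module _ (X : Flow G) {p} (path : Path s t p) (p⊆ : All (λ e → on X e ≢ 0) p) where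
    private
      rest : E digraph → ℕ
      rest e = on X e ∸ count p e

      -- A path in a DAG uses an edge at most once, and `X` is at least 1 on the edges of `p`. Hence
      -- the truncated subtraction in `rest` is exact.
      count≤ : ∀ e → count p e ≤ on X e
      count≤ e with count p e in eq
      ... | zero  = z≤n
      ... | suc n = subst (_≤ on X e) eq
        (ℕ.≤-trans (count≤1 e (edge-on-path-unique p path))
          (ℕ.n≢0⇒n>0 (All.lookup p⊆ (count≢0⁻ p λ ≡0 → ℕ.1+n≢0 (trans (sym eq) ≡0)))))

      rest-∑ : ∀ xs → ∑ xs rest + ∑ xs (count p) ≡ ∑ xs (on X)
      rest-∑ xs = trans (sym (∑-+ xs rest (count p))) (∑-cong xs λ e → ℕ.m∸n+n≡m (count≤ e))

    minusPath : Flow G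
    minusPath = record { on = rest ; conserve = λ v v≢s v≢t →
      ℕ.+-cancelʳ-≡ (inflow (count p) v) _ _ (begin
      inflow rest v + inflow (count p) v    ≡⟨ rest-∑ (inEdges full v) ⟩
      inflow (on X) v                       ≡⟨ conserve X v v≢s v≢t ⟩
      outflow (on X) v                      ≡⟨ rest-∑ (outEdges full v) ⟨
      outflow rest v + outflow (count p) v  ≡⟨ cong (outflow rest v +_) (path-conserve path v v≢s v≢t) ⟨
      outflow rest v + inflow (count p) v   ∎) }
      where open ≡-Reasoning

    minusPath-value : s ≢ t → suc ∣ minusPath ∣ ≡ ∣ X ∣
    minusPath-value s≢t = begin
      1 + ∣ minusPath ∣                    ≡⟨ ℕ.+-comm 1 _ ⟩
      ∣ minusPath ∣ + 1                    ≡⟨ cong (∣ minusPath ∣ +_) (path-value s≢t path) ⟨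
      ∣ minusPath ∣ + outflow (count p) s  ≡⟨ rest-∑ (outEdges full s) ⟩
      ∣ X ∣                                ∎
      where open ≡-Reasoning

  -- Flow decomposition by induction on the value: follow non-zero edges from `s` to `t` and
  -- subtract the unit flow of this path. A flow of value 0 is zero on every edge, so it needs no
  -- path.
  decompose : ∀ n (X : Flow G) → ∣ X ∣ ≡ n → ∃[ ps ] IsPathCover (support X) s t ps × length ps ≡ n
  decompose zero X ∣X∣≡0 = [] , record
    { paths  = []
    ; covers = λ {e} e∈ → contradiction ∣X∣≡0 (value≢0 X (e , support⁻ X e∈))
    } , refl
  decompose (suc n) X ∣X∣≡1+n
    with e , Xe≢0 , refl ← out-edge {on X} {s} (λ ≡0 → ℕ.1+n≢0 (trans (sym ∣X∣≡1+n) ≡0))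
    with p , path , p⊆ ← reach-step Xe≢0 (reach-to-t X Xe≢0)
    with s≢t ← nonzero⇒s≢t X (e , Xe≢0)
    with ps , cover , refl ← decompose n (minusPath X path p⊆)
                               (ℕ.suc-injective (trans (minusPath-value X path p⊆ s≢t) ∣X∣≡1+n))
    = p ∷ ps , record
      { paths  = support-path⁺ X p path p⊆ ∷ All.map (λ {q} → enlarge q) (IsPathCover.paths cover)
      ; covers = cover-edge
      } , refl
    where
    X′ : Flow G
    X′ = minusPath X path p⊆

    enlarge : ∀ q → IsPath (support X′) s t q → IsPath (support X) s t q
    enlarge q qpath with qpath′ , q⊆ ← support-path⁻ X′ q qpath =
      support-path⁺ X q qpath′ (All.map (λ {e} X′e≢0 Xe≡0 →
        X′e≢0 (trans (cong (_∸ count p e) Xe≡0) (ℕ.0∸n≡0 (count p e)))) q⊆)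

    cover-edge : ∀ {e} → e ∈ Subgraph.edges (support X) → Any (e ∈ₗ_) (p ∷ ps)
    cover-edge {e} e∈ with on X′ e ℕ.≟ 0
    ... | no  X′e≢0 = there (IsPathCover.covers cover (support⁺ X′ X′e≢0))
    -- An edge that loses all its flow in the subtraction must lie on `p`.
    ... | yes X′e≡0 = here (count≢0⁻ p λ count≡0 →
      support⁻ X e∈ (trans (cong (on X e ∸_) (sym count≡0)) X′e≡0))

  module _ (X : Flow G) {A : V digraph → Set} (A? : Decidable A) (A-s : A s) (¬A-t : ¬ A t)
           {C : E digraph → Set} (C? : Decidable C)
           (leaving : ∀ {e} → on X e ≢ 0 → A (src e) → ¬ A (tgt e) → C e) where
    private
      -- Double counting: the flow at the vertices of `A` is regrouped by edges. It is used with
      -- `end` equal to `src` and to `tgt`.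
      regroup : (end : E digraph → V digraph) →
        ∑ (allFin _) (λ v → ⟦ A? v ⟧ * ∑ (allFin _) (λ e → on X e * ⟦ v ≟ end e ⟧)) ≡
        ∑ (allFin _) (λ e → on X e * ⟦ A? (end e) ⟧)
      regroup end = begin
        ∑ Vs (λ v → ⟦ A? v ⟧ * ∑ Es (λ e → on X e * ⟦ v ≟ end e ⟧))
          ≡⟨ ∑-cong Vs (λ v → ∑-*ˡ Es ⟦ A? v ⟧ (λ e → on X e * ⟦ v ≟ end e ⟧)) ⟨
        ∑ Vs (λ v → ∑ Es (λ e → ⟦ A? v ⟧ * (on X e * ⟦ v ≟ end e ⟧)))
          ≡⟨ ∑-swap Vs Es (λ v e → ⟦ A? v ⟧ * (on X e * ⟦ v ≟ end e ⟧)) ⟩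
        ∑ Es (λ e → ∑ Vs (λ v → ⟦ A? v ⟧ * (on X e * ⟦ v ≟ end e ⟧)))
          ≡⟨ ∑-cong Es (λ e → ∑-cong Vs λ v → trans (sym (ℕ.*-assoc ⟦ A? v ⟧ (on X e) _))
               (cong (_* ⟦ v ≟ end e ⟧) (ℕ.*-comm ⟦ A? v ⟧ (on X e)))) ⟩
        ∑ Es (λ e → ∑ Vs (λ v → on X e * ⟦ A? v ⟧ * ⟦ v ≟ end e ⟧))
          ≡⟨ ∑-cong Es (λ e → ∑-delta (allFin⁺ _) (∈-allFin (end e)) (λ v → on X e * ⟦ A? v ⟧)) ⟩
        ∑ Es (λ e → on X e * ⟦ A? (end e) ⟧) ∎
        where
        open ≡-Reasoning
        Vs = allFin #V
        Es = allFin #E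

      -- Conservation weighted by membership in `A`. The vertex `s` lies in `A` and has no inflow,
      -- so it contributes the value; `t` lies outside `A` and contributes nothing.
      balance : ∀ v → ⟦ A? v ⟧ * outflow (on X) v ≡ ∣ X ∣ * ⟦ v ≟ s ⟧ + ⟦ A? v ⟧ * inflow (on X) v
      balance v with v ≟ s
      ... | yes refl rewrite ⟦⟧-yes (A? s) A-s | inflow-s (on X) =
        trans (ℕ.+-identityʳ _) (sym (trans (ℕ.+-identityʳ _) (ℕ.*-identityʳ _)))
      ... | no v≢s rewrite ℕ.*-zeroʳ ∣ X ∣ with v ≟ t
      ...   | yes refl rewrite ⟦⟧-no (A? t) ¬A-t = refl
      ...   | no  v≢t = cong (⟦ A? v ⟧ *_) (sym (conserve X v v≢s v≢t))

      pointwise : ∀ e → on X e * ⟦ A? (src e) ⟧ ≤ on X e * ⟦ C? e ⟧ + on X e * ⟦ A? (tgt e) ⟧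
      pointwise e with on X e ℕ.≟ 0
      ... | yes eq rewrite eq = z≤n
      ... | no Xe≢0 rewrite sym (ℕ.*-distribˡ-+ (on X e) ⟦ C? e ⟧ ⟦ A? (tgt e) ⟧) =
        ℕ.*-monoʳ-≤ (on X e) le
        where
        le : ⟦ A? (src e) ⟧ ≤ ⟦ C? e ⟧ + ⟦ A? (tgt e) ⟧
        le with A? (tgt e)
        ... | yes _  = ℕ.≤-trans (⟦⟧≤1 (A? (src e))) (ℕ.m≤n+m 1 ⟦ C? e ⟧)
        ... | no ¬At = ℕ.≤-trans (⟦⟧-mono (A? (src e)) (C? e) λ As → leaving Xe≢0 As ¬At)
                                 (ℕ.m≤m+n ⟦ C? e ⟧ 0)

    -- Conservation summed over `A`: the flow out of vertices of `A` is the value plus the flow into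
    -- vertices of `A`. Edges inside `A` occur on both sides, so `entering`, which counts every edge
    -- with head in `A`, is carried along and cancelled.
    value≤cut : ∣ X ∣ ≤ ∑ (filter C? (allFin _)) (on X)
    value≤cut = ℕ.+-cancelʳ-≤ entering _ _ (begin
      ∣ X ∣ + entering
        ≡⟨ cong₂ _+_ (∑-delta (allFin⁺ _) (∈-allFin s) (λ _ → ∣ X ∣)) (regroup tgt) ⟨
      ∑ Vs (λ v → ∣ X ∣ * ⟦ v ≟ s ⟧) + ∑ Vs (λ v → ⟦ A? v ⟧ * ∑ Es (λ e → on X e * ⟦ v ≟ tgt e ⟧))
        ≡⟨ cong (∑ Vs (λ v → ∣ X ∣ * ⟦ v ≟ s ⟧) +_)
             (∑-cong Vs λ v → cong (⟦ A? v ⟧ *_) (inflow-formula (on X) v)) ⟨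
      ∑ Vs (λ v → ∣ X ∣ * ⟦ v ≟ s ⟧) + ∑ Vs (λ v → ⟦ A? v ⟧ * inflow (on X) v)
        ≡⟨ ∑-+ Vs _ _ ⟨
      ∑ Vs (λ v → ∣ X ∣ * ⟦ v ≟ s ⟧ + ⟦ A? v ⟧ * inflow (on X) v)
        ≡⟨ ∑-cong Vs balance ⟨
      ∑ Vs (λ v → ⟦ A? v ⟧ * outflow (on X) v)
        ≡⟨ ∑-cong Vs (λ v → cong (⟦ A? v ⟧ *_) (outflow-formula (on X) v)) ⟩
      ∑ Vs (λ v → ⟦ A? v ⟧ * ∑ Es (λ e → on X e * ⟦ v ≟ src e ⟧))
        ≡⟨ regroup src ⟩
      ∑ Es (λ e → on X e * ⟦ A? (src e) ⟧)
        ≤⟨ ∑-mono Es (λ {e} _ → pointwise e) ⟩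
      ∑ Es (λ e → on X e * ⟦ C? e ⟧ + on X e * ⟦ A? (tgt e) ⟧)
        ≡⟨ ∑-+ Es _ _ ⟩
      ∑ Es (λ e → on X e * ⟦ C? e ⟧) + entering
        ≡⟨ cong (_+ entering) (∑-filter C? Es (on X)) ⟨
      ∑ (filter C? Es) (on X) + entering ∎)
      where
      open ℕ.≤-Reasoning
      Vs = allFin #V
      Es = allFin #E
      entering = ∑ Es (λ e → on X e * ⟦ A? (tgt e) ⟧)

-- The weight condition with denominators cleared.

/≤/⁺ : ∀ {n w m} .{{_ : NonZero w}} → n ≤ w * m → ℤ.+ n / w ≤ℚ ℤ.+ m / 1
/≤/⁺ {n} {suc w} {m} n≤wm = ℚ.toℚᵘ-cancel-≤
  (ℚᵘ.≤-respˡ-≃ (ℚᵘ.≃-sym (ℚ.toℚᵘ-fromℚᵘ (mkℚᵘ (ℤ.+ n) w)))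
    (ℚᵘ.≤-respʳ-≃ (ℚᵘ.≃-sym (ℚ.toℚᵘ-fromℚᵘ (mkℚᵘ (ℤ.+ m) 0)))
      (*≤* (subst₂ ℤ._≤_ (sym (ℤ.*-identityʳ (ℤ.+ n)))
             (trans (cong ℤ.+_ (ℕ.*-comm (suc w) m)) (ℤ.pos-* m (suc w))) (ℤ.+≤+ n≤wm)))))

/≤/⁻ : ∀ {n w m} .{{_ : NonZero w}} → ℤ.+ n / w ≤ℚ ℤ.+ m / 1 → n ≤ w * m
/≤/⁻ {n} {suc w} {m} le
  with *≤* le′ ← ℚᵘ.≤-respˡ-≃ (ℚ.toℚᵘ-fromℚᵘ (mkℚᵘ (ℤ.+ n) w))
                   (ℚᵘ.≤-respʳ-≃ (ℚ.toℚᵘ-fromℚᵘ (mkℚᵘ (ℤ.+ m) 0)) (ℚ.toℚᵘ-mono-≤ le))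
  = ℤ.drop‿+≤+ (subst₂ ℤ._≤_ (ℤ.*-identityʳ (ℤ.+ n))
      (sym (trans (cong ℤ.+_ (ℕ.*-comm (suc w) m)) (ℤ.pos-* m (suc w)))) le′)

module HeavyPaths (G : STDAG) where
  open STDAG G
  open Flow

  -- The bound by the quotient of the value by `w`, stated in ℕ and for any `w`, whether or not it
  -- is the width.
  HasHeavyPath : Flow G → ℕ → Set
  HasHeavyPath X w = ∃[ P ] IsPath (support X) s t P × (∀ {e} → e ∈ₗ P → ∣ X ∣ ≤ w * on X e)

  HasHeavyPaths : Set
  HasHeavyPaths = ∀ X → IsNonZero X → ∀ {w} → IsFlowWidth X w → HasHeavyPath X w

  largeWeight⁻ : HasPathsOfLargeWeight G → HasHeavyPaths
  largeWeight⁻ heavyPath X X≢0 {w} width =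
    let P , path , carries = heavyPath X X≢0 width
    in P , path , λ {e} e∈P → /≤/⁻ {∣ X ∣} {w} {on X e} {{width-nonZero X X≢0 width}} (carries e∈P)

  largeWeight⁺ : HasHeavyPaths → HasPathsOfLargeWeight G
  largeWeight⁺ heavyPath X X≢0 {w} width =
    let P , path , heavy = heavyPath X X≢0 width
    in P , path , λ {e} e∈P → /≤/⁺ {∣ X ∣} {w} {on X e} {{width-nonZero X X≢0 width}} (heavy e∈P)

-- Paths of large weight imply width-stability.

module HeavyPaths⇒Stable (G : STDAG) where
  open STDAG G
  open Acyclic G
  open Flow
  open Flows G
  open HeavyPaths G

  -- Equality of the supports as subgraphs, so that covers and widths transport by `subst`.
  support-cong : ∀ (X Y : Flow G) → (∀ {e} → on X e ≢ 0 → on Y e ≢ 0) →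
    (∀ {e} → on Y e ≢ 0 → on X e ≢ 0) → support X ≡ support Y
  support-cong X Y X⊆Y Y⊆X = cong (spanning digraph)
    (tabulate-cong λ e → does-⇔ (mk⇔ X⊆Y Y⊆X) (¬? (on X e ℕ.≟ 0)) (¬? (on Y e ℕ.≟ 0)))

  _∙_⊕_ : ℕ → Flow G → Flow G → Flow G
  M ∙ X ⊕ Y = record
    { on       = λ e → M * on X e + on Y e
    ; conserve = λ v v≢s v≢t → trans (linear (inEdges full v))
        (trans (cong₂ (λ a b → M * a + b) (conserve X v v≢s v≢t) (conserve Y v v≢s v≢t))
               (sym (linear (outEdges full v))))
    }
    where
    linear : ∀ xs → ∑ xs (λ e → M * on X e + on Y e) ≡ M * ∑ xs (on X) + ∑ xs (on Y)
    linear xs = trans (∑-+ xs _ (on Y)) (cong (_+ ∑ xs (on Y)) (∑-*ˡ xs M (on X)))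

  ∣∙⊕∣ : ∀ M X Y → ∣ M ∙ X ⊕ Y ∣ ≡ M * ∣ X ∣ + ∣ Y ∣
  ∣∙⊕∣ M X Y = trans (∑-+ (outEdges full s) _ (on Y))
    (cong (_+ ∣ Y ∣) (∑-*ˡ (outEdges full s) M (on X)))

  -- M = w′ S + 1 makes M w exceed w′ (M + S) for all w > w′.
  heavy⇒1< : ∀ {w w′ S x y} k → w′ < w → y ≤ S →
    suc (w′ * S) * w + k ≤ w′ * (suc (w′ * S) * x + y) → 1 < x
  heavy⇒1< {w} {w′} {S} {x} {y} k w′<w y≤S le = ℕ.≰⇒> λ x≤1 → ℕ.<-irrefl refl (begin-strict
    w′ * (M * x + y)  ≤⟨ ℕ.*-monoʳ-≤ w′ (ℕ.+-mono-≤ (ℕ.*-monoʳ-≤ M x≤1) y≤S) ⟩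
    w′ * (M * 1 + S)  ≡⟨ cong (λ a → w′ * (a + S)) (ℕ.*-identityʳ M) ⟩
    w′ * (M + S)      ≡⟨ ℕ.*-distribˡ-+ w′ M S ⟩
    w′ * M + w′ * S   <⟨ ℕ.+-monoʳ-< (w′ * M) (ℕ.n<1+n (w′ * S)) ⟩
    w′ * M + M        ≡⟨ ℕ.+-comm (w′ * M) M ⟩
    suc w′ * M        ≡⟨ ℕ.*-comm (suc w′) M ⟩
    M * suc w′        ≤⟨ ℕ.*-monoʳ-≤ M w′<w ⟩
    M * w             ≤⟨ ℕ.m≤m+n (M * w) k ⟩
    M * w + k         ≤⟨ le ⟩
    w′ * (M * x + y)  ∎)
    where
    open ℕ.≤-Reasoning
    M = suc (w′ * S)

  module Shorten (X Y : Flow G) (X≤Y : X ≤F Y) (Y≢0 : IsNonZero Y) {w′ ps}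
                 (cover : IsPathCover (support X) s t ps) (w′<w : w′ < length ps) where

    s≢t : s ≢ t
    s≢t = nonzero⇒s≢t Y Y≢0

    paths : All (IsPath full s t) ps
    paths = All.map (λ {p} → proj₁ ∘ support-path⁻ X p) (IsPathCover.paths cover)

    -- Replaces `X` by a flow with the same support whose value is exactly the number of paths in
    -- the cover.
    X₀ : Flow G
    X₀ = pathsFlow paths

    X₀⊆X : ∀ {e} → on X₀ e ≢ 0 → on X e ≢ 0
    X₀⊆X X₀e≢0 with p , p∈ , e∈p ← find (pathsFlow≢0⁻ paths X₀e≢0) =
      All.lookup (proj₂ (support-path⁻ X p (All.lookup (IsPathCover.paths cover) p∈))) e∈p

    X⊆X₀ : ∀ {e} → on X e ≢ 0 → on X₀ e ≢ 0
    X⊆X₀ Xe≢0 = pathsFlow≢0⁺ paths (IsPathCover.covers cover (support⁺ X Xe≢0))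

    -- `S` bounds every value of `Y`; `M` is large enough that an edge heavy for `Z` has `X₀` at
    -- least 2.
    S M : ℕ
    S = ∑ (allFin _) (on Y)
    M = suc (w′ * S)

    Z : Flow G
    Z = M ∙ X₀ ⊕ Y

    Z⊆Y : ∀ {e} → on Z e ≢ 0 → on Y e ≢ 0
    Z⊆Y {e} Ze≢0 Ye≡0 = Ze≢0 (trans (cong₂ (λ a b → M * a + b) X₀e≡0 Ye≡0) (cong (_+ 0) (ℕ.*-zeroʳ M)))
      where
      X₀e≡0 : on X₀ e ≡ 0
      X₀e≡0 with on X₀ e ℕ.≟ 0
      ... | yes eq = eq
      ... | no ≢0  = contradiction (ℕ.n≤0⇒n≡0 (ℕ.≤-trans (X≤Y e) (ℕ.≤-reflexive Ye≡0))) (X₀⊆X ≢0)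

    Y⊆Z : ∀ {e} → on Y e ≢ 0 → on Z e ≢ 0
    Y⊆Z {e} Ye≢0 Ze≡0 = Ye≢0 (ℕ.m+n≡0⇒n≡0 (M * on X₀ e) Ze≡0)

    -- Since `X ≤ Y`, adding a multiple of `X₀` to `Y` creates no new edge. So `Z` also has width
    -- `w′`, and its heavy path carries a `w′`-th of its value.
    supportZ : support Y ≡ support Z
    supportZ = support-cong Y Z Y⊆Z Z⊆Y

    ∣Z∣ : ∣ Z ∣ ≡ M * length ps + ∣ Y ∣
    ∣Z∣ = trans (∣∙⊕∣ M X₀ Y) (cong (λ a → M * a + ∣ Y ∣) (pathsFlow-value s≢t paths))

    module _ {P} (P-path : IsPath full s t P) (heavy : ∀ {e} → e ∈ₗ P → ∣ Z ∣ ≤ w′ * on Z e) where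

      1<X₀ : ∀ {e} → e ∈ₗ P → 1 < on X₀ e
      1<X₀ {e} e∈P = heavy⇒1< {length ps} {w′} {S} {on X₀ e} {on Y e} ∣ Y ∣ w′<w
        (f≤∑ (on Y) (∈-allFin e)) (subst (_≤ w′ * on Z e) ∣Z∣ (heavy e∈P))

      P⊆X₀ : All (λ e → on X₀ e ≢ 0) P
      P⊆X₀ = All.tabulate λ e∈P → ℕ.m<n⇒n≢0 (1<X₀ e∈P)

      X₁ : Flow G
      X₁ = minusPath X₀ P-path P⊆X₀

      X₁⊆X : ∀ {e} → on X₁ e ≢ 0 → on X e ≢ 0
      X₁⊆X {e} X₁e≢0 = X₀⊆X λ X₀e≡0 →
        X₁e≢0 (trans (cong (_∸ count P e) X₀e≡0) (ℕ.0∸n≡0 (count P e)))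

      -- Off `P` nothing is subtracted; on `P` the value of `X₀` is at least 2 and drops by at most
      -- 1.
      X⊆X₁ : ∀ {e} → on X e ≢ 0 → on X₁ e ≢ 0
      X⊆X₁ {e} Xe≢0 X₁e≡0 = ℕ.<⇒≱ (1<X₀ e∈P)
        (ℕ.≤-trans X₀e≤count (count≤1 e (edge-on-path-unique P P-path)))
        where
        X₀e≤count : on X₀ e ≤ count P e
        X₀e≤count = ℕ.m∸n≡0⇒m≤n X₁e≡0

        e∈P : e ∈ₗ P
        e∈P = count≢0⁻ P λ count≡0 →
          X⊆X₀ Xe≢0 (ℕ.n≤0⇒n≡0 (ℕ.≤-trans X₀e≤count (ℕ.≤-reflexive count≡0)))

      shorter-cover : ∃[ qs ] IsPathCover (support X) s t qs × suc (length qs) ≡ length ps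
      shorter-cover with qs , cover₁ , eq ← decompose ∣ X₁ ∣ X₁ refl =
        qs , subst (λ H → IsPathCover H s t qs) (support-cong X₁ X X₁⊆X X⊆X₁) cover₁ ,
        trans (cong suc eq) (trans (minusPath-value X₀ P-path P⊆X₀ s≢t) (pathsFlow-value s≢t paths))

    shorten : HasHeavyPaths → IsFlowWidth Y w′ →
      ∃[ qs ] IsPathCover (support X) s t qs × suc (length qs) ≡ length ps
    shorten heavyPath widthY
      with P , P-path , heavy ← heavyPath Z (proj₁ Y≢0 , Y⊆Z (proj₂ Y≢0))
                                  (subst (λ H → IsWidth H s t w′) supportZ widthY)
      = shorter-cover (proj₁ (support-path⁻ Z P P-path)) heavy

  -- The weight hypothesis concerns non-zero flows, so `Y = 0` is settled apart: then `X` vanishes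
  -- too, and the empty cover forces its width to be 0.
  support-empty : ∀ (X Y : Flow G) → X ≤F Y → ¬ IsNonZero Y → IsPathCover (support X) s t []
  support-empty X Y X≤Y Y≡0 = record
    { paths  = []
    ; covers = λ {e} e∈ → contradiction
        (e , λ Ye≡0 → support⁻ X e∈ (ℕ.n≤0⇒n≡0 (ℕ.≤-trans (X≤Y e) (ℕ.≤-reflexive Ye≡0)))) Y≡0
    }

  width-mono : HasHeavyPaths → ∀ X Y → X ≤F Y → IsNonZero Y →
    ∀ {w w′} → IsFlowWidth X w → IsFlowWidth Y w′ → ¬ w′ < w
  width-mono heavyPath X Y X≤Y Y≢0 {w} {w′} widthX widthY w′<w =
    let ps , cover , ∣ps∣≡w = IsWidth.attained widthX
        qs , cover′ , eq    = Shorten.shorten X Y X≤Y Y≢0 cover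
                                (subst (w′ <_) (sym ∣ps∣≡w) w′<w) heavyPath widthY
    in ℕ.<⇒≱ (ℕ.≤-reflexive (trans eq ∣ps∣≡w)) (IsWidth.minimal widthX cover′)

  heavyPaths⇒stable : HasHeavyPaths → WidthStable G
  heavyPaths⇒stable heavyPath X Y X≤Y widthX widthY = case any? (λ e → ¬? (on Y e ℕ.≟ 0)) of λ where
    (yes Y≢0) → ℕ.≮⇒≥ (width-mono heavyPath X Y X≤Y Y≢0 widthX widthY)
    (no Y≡0)  → ℕ.≤-trans (IsWidth.minimal widthX (support-empty X Y X≤Y Y≡0)) z≤n

-- Width-stability excludes funnels with a central path.

module Stable⇒NoFunnel (G : STDAG) where
  open STDAG G
  open IsSTDAG isSTDAG using (acyclic)
  open Paths full
  open Acyclic G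
  open Flow
  open Flows G

  -- Descent on the length of a cover yields a minimal one up to double negation, which is enough
  -- because instability is a negation.
  width-exists : ∀ {H : Subgraph digraph} {s t ps} → IsPathCover H s t ps → ¬ ¬ (∃[ w ] IsWidth H s t w)
  width-exists {H} {s} {t} {ps} cover no-width = go (<-wellFounded (length ps)) cover refl
    where
    go : ∀ {n ps} → Acc _<_ n → IsPathCover H s t ps → length ps ≡ n → ⊥
    go {n} {ps} (acc rs) cover eq = no-width (n , record
      { attained = ps , cover , eq
      ; minimal  = λ cover′ → ℕ.≮⇒≥ λ lt → go (rs lt) cover′ refl
      })

  module _ (F : Subgraph digraph) {s′ t′} (funnel : IsFunnel F s′ t′) where
    open IsFunnel funnel renaming (isSTDAG to F-isSTDAG)
    private
      module F = Subgraph F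
      module FP = Paths F

    FPath = IsPath F

    -- If `k` led from `u` to `v` in `F`, a private edge of `α₁ ++ k ++ β₁` would lie in `α₁`,
    -- shared with the path that ends in `β₂`, or in `k ++ β₁`, shared with the path that begins
    -- with `α₂`.
    no-path-merging-forking : ∀ {u v α₁ α₂ β₁ β₂} →
      FPath s′ u α₁ → FPath s′ u α₂ → α₁ ≢ α₂ → FPath v t′ β₁ → FPath v t′ β₂ → β₁ ≢ β₂ →
      ∀ k → ¬ FPath u v k
    no-path-merging-forking {α₁ = α₁} {α₂} {β₁} {β₂} α₁-path α₂-path α₁≢α₂ β₁-path β₂-path β₁≢β₂ k k-path =
      let e , e∈ , e-private = private-edge (through α₁ α₁-path β₁ β₁-path)
      in Sum.[ (λ e∈α₁ → e-private (through α₁ α₁-path β₂ β₂-path)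
                 (λ eq → β₁≢β₂ (sym (++-cancelˡ k _ _ (++-cancelˡ α₁ _ _ eq)))) (∈-++⁺ˡ e∈α₁))
             , (λ e∈kβ₁ → e-private (through α₂ α₂-path β₁ β₁-path)
                 (λ eq → α₁≢α₂ (sym (++-cancelʳ _ α₂ α₁ eq))) (∈-++⁺ʳ α₂ e∈kβ₁))
             ] (∈-++⁻ α₁ e∈)
      where
      through : ∀ α → FPath s′ _ α → ∀ β → FPath _ t′ β → FPath s′ t′ (α ++ k ++ β)
      through α α-path β β-path = FP.concat α {k ++ β} α-path (FP.concat k {β} k-path β-path)

    -- A path that leaves F between two edges of F would close a cycle through s′ or t′.
    module _ {p₀ p₁} (p₀-path : Path s s′ p₀) (p₁-path : Path t′ t p₁)
             {P : E digraph → Set} (P⊆ : ∀ {e} → P e → e ∈ₗ p₀ ⊎ e ∈ F.edges ⊎ e ∈ₗ p₁) where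

      between-in-F : ∀ {e f r} → e ∈ F.edges → f ∈ F.edges → Path (tgt e) (src f) r → All P r →
        FPath (tgt e) (src f) r
      between-in-F {e} {f} {r} e∈ f∈ r-path r⊆ = move F r r-path (All.tabulate in-F) (F.tgt∈ e∈)
        where
        in-F : ∀ {x} → x ∈ₗ r → x ∈ F.edges
        in-F {x} x∈r with P⊆ (All.lookup r⊆ x∈r) | split-∈ r-path x∈r
        ... | inj₂ (inj₁ x∈F) | _ = x∈F
        -- The cycle runs from the head of `x` along `p₀` to `s′`, inside `F` to `e`, over `e`, and
        -- along `r` back to `x`.
        ... | inj₁ x∈p₀ | r₁ , _ , _ , r₁-path , _
          with _ , q , _ , _ , q-path ← split-∈ p₀-path x∈p₀
             | a , a-path ← from-source F F-isSTDAG (F.src∈ e∈)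
             = contradiction (concat q q-path (concat a (path-in-full F a a-path) (∈⊤ , refl , r₁-path)))
                             (no-cycle (q ++ a ++ e ∷ r₁))
        ... | inj₂ (inj₂ x∈p₁) | _ , r₂ , _ , _ , r₂-path
          with q , _ , _ , q-path , _ ← split-∈ p₁-path x∈p₁
             | b , b-path ← to-sink F F-isSTDAG (F.tgt∈ f∈)
             = contradiction (concat r₂ r₂-path (∈⊤ , refl , concat b (path-in-full F b b-path) q-path))
                             (no-cycle (r₂ ++ f ∷ b ++ q))

      -- The stretch between `e` and `f` lies in `F`, so some `s′`-`t′` path `z` of `F` uses both
      -- edges. Privacy of `e` makes `z` equal to `A`, and privacy of `f` makes it equal to `B`.
      private-separated : ∀ {A B e f r} → FPath s′ t′ A → FPath s′ t′ B →
        IsPrivateEdge F s′ t′ A e → IsPrivateEdge F s′ t′ B f →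
        Path (tgt e) (src f) r → All P r → A ≡ B
      private-separated {A} {B} {e} {f} {r} A-path B-path (e∈A , e-private) (f∈B , f-private) r-path r⊆
        with e∈F ← All.lookup (FP.edges-in A A-path) e∈A
           | f∈F ← All.lookup (FP.edges-in B B-path) f∈B
        with a , a-path ← from-source F F-isSTDAG (F.src∈ e∈F)
           | b , b-path ← to-sink F F-isSTDAG (F.tgt∈ f∈F)
        = trans (sym (equal A e-private (∈-++⁺ʳ a (here refl))))
                (equal B f-private (∈-++⁺ʳ a (there (∈-++⁺ʳ r (here refl)))))
        where
        z = a ++ e ∷ r ++ f ∷ b
        z-path : FPath s′ t′ z
        z-path = FP.concat a a-path (e∈F , refl ,
          FP.concat r (between-in-F e∈F f∈F r-path r⊆) (f∈F , refl , b-path))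

        equal : ∀ A {x} → (∀ {q} → FPath s′ t′ q → q ≢ A → x ∉ₗ q) → x ∈ₗ z → z ≡ A
        equal A x-private x∈z = decidable-stable (≡-dec _≟_ z A) λ z≢A → x-private z-path z≢A x∈z

      separated : ∀ {A B e f u v q} → FPath s′ t′ A → FPath s′ t′ B →
        IsPrivateEdge F s′ t′ A e → IsPrivateEdge F s′ t′ B f →
        Path u v q → All P q → e ∈ₗ q → f ∈ₗ q → A ≡ B
      separated {A} {B} A-path B-path A-e B-f q-path q⊆ e∈q f∈q with order q-path q⊆ e∈q f∈q
      ... | inj₁ refl = decidable-stable (≡-dec _≟_ A B) λ A≢B →
        proj₂ A-e B-path (A≢B ∘ sym) (proj₁ B-f)
      ... | inj₂ (inj₁ (r , r-path , r⊆)) = private-separated A-path B-path A-e B-f r-path r⊆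
      ... | inj₂ (inj₂ (r , r-path , r⊆)) = sym (private-separated B-path A-path B-f A-e r-path r⊆)

  module CentralPath (F : Subgraph digraph) {s′ t′} (funnel : IsFunnel F s′ t′) {u v}
    {α₁ α₂ μ ν β₁ β₂ p₀ p₁ c : List (E digraph)}
    (α₁-path : IsPath F s′ u α₁) (α₂-path : IsPath F s′ u α₂) (α₁≢α₂ : α₁ ≢ α₂)
    (β₁-path : IsPath F v t′ β₁) (β₂-path : IsPath F v t′ β₂) (β₁≢β₂ : β₁ ≢ β₂)
    (μ-path : IsPath F u t′ μ) (ν-path : IsPath F s′ v ν)
    (p₀-path : Path s s′ p₀) (p₁-path : Path t′ t p₁) (c-path : Path u v c) where

    open IsFunnel funnel using (private-edge)
    private
      module F = Subgraph F
      module FP = Paths F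

      no-path-u-v : ∀ k → ¬ IsPath F u v k
      no-path-u-v = no-path-merging-forking F funnel {u} {v} {α₁} {α₂} {β₁} {β₂}
        α₁-path α₂-path α₁≢α₂ β₁-path β₂-path β₁≢β₂

      -- If the two paths agree, one of `α` and `ν` is a prefix of the other. The surplus `k` is
      -- either a path of `F` from `u` to `v`, which is excluded, or one from `v` to `u`. In the
      -- latter case `c ++ k` is a closed path, so `k` is empty and `u = v`, and the empty path is
      -- excluded as well.
      α≢β : ∀ α β → IsPath F s′ u α → IsPath F v t′ β → α ++ μ ≢ ν ++ β
      α≢β α β α-path β-path eq with ++-compare α ν eq
      ... | inj₁ (k , ν≡ , _) =
        let _ , α-path′ , k-path = FP.split α (subst (IsPath F s′ v) ν≡ ν-path)
        in no-path-u-v k (subst (λ x → IsPath F x v k) (FP.end-unique α α-path′ α-path) k-path)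
      ... | inj₂ (k , α≡ , _) =
        let _ , ν-path′ , k-path = FP.split ν (subst (IsPath F s′ u) α≡ α-path)
            k-path′ = subst (λ x → IsPath F x u k) (FP.end-unique ν ν-path′ ν-path) k-path
            k≡[]    = ++-conicalʳ c k
                        (acyclic {p = c ++ k} (concat c {k} c-path (path-in-full F k k-path′)))
            v≡u , _ = subst (IsPath F v u) k≡[] k-path′
        in no-path-u-v [] (sym v≡u , FP.tgt-vertex α α-path)

      A₁ A₂ B₁ B₂ C : List (E digraph)
      A₁ = α₁ ++ μ
      A₂ = α₂ ++ μ
      B₁ = ν ++ β₁
      B₂ = ν ++ β₂
      C  = α₂ ++ c ++ β₂

      Ps : List (List (E digraph))
      Ps = A₁ ∷ A₂ ∷ B₁ ∷ B₂ ∷ []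

      Ps-unique : Unique Ps
      Ps-unique = ((λ eq → α₁≢α₂ (++-cancelʳ μ α₁ α₂ eq))
                    ∷ α≢β α₁ β₁ α₁-path β₁-path ∷ α≢β α₁ β₂ α₁-path β₂-path ∷ [])
                ∷ (α≢β α₂ β₁ α₂-path β₁-path ∷ α≢β α₂ β₂ α₂-path β₂-path ∷ [])
                ∷ ((λ eq → β₁≢β₂ (++-cancelˡ ν β₁ β₂ eq)) ∷ [])
                ∷ [] ∷ []

      Ps-paths : All (IsPath F s′ t′) Ps
      Ps-paths = FP.concat α₁ {μ} α₁-path μ-path ∷ FP.concat α₂ {μ} α₂-path μ-path
               ∷ FP.concat ν {β₁} ν-path β₁-path ∷ FP.concat ν {β₂} ν-path β₂-path ∷ []

      -- `F` has its own source and sink; `p₀` and `p₁` prolong its paths to `s`-`t` paths of `G`,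
      -- as flows on `G` require.
      extend : List (E digraph) → List (E digraph)
      extend q = p₀ ++ q ++ p₁

      ∈-extend⁺ : ∀ {e} q → e ∈ₗ p₀ ⊎ e ∈ₗ q ⊎ e ∈ₗ p₁ → e ∈ₗ extend q
      ∈-extend⁺ q (inj₁ e∈p₀)        = ∈-++⁺ˡ e∈p₀
      ∈-extend⁺ q (inj₂ (inj₁ e∈q))  = ∈-++⁺ʳ p₀ (∈-++⁺ˡ e∈q)
      ∈-extend⁺ q (inj₂ (inj₂ e∈p₁)) = ∈-++⁺ʳ p₀ (∈-++⁺ʳ q e∈p₁)

      ∈-extend⁻ : ∀ {e} q → e ∈ₗ extend q → e ∈ₗ p₀ ⊎ e ∈ₗ q ⊎ e ∈ₗ p₁
      ∈-extend⁻ q e∈ = Sum.map₂ (∈-++⁻ q) (∈-++⁻ p₀ e∈)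

      extend-path : ∀ {q} → Path s′ t′ q → Path s t (extend q)
      extend-path {q} path = concat p₀ {q ++ p₁} p₀-path (concat q {p₁} path p₁-path)

      X-paths : All (Path s t) (map extend Ps)
      X-paths = map⁺ (All.map (λ {q} → extend-path {q} ∘ path-in-full F q) Ps-paths)

      C-path : Path s′ t′ C
      C-path = concat α₂ {c ++ β₂} (path-in-full F α₂ α₂-path)
        (concat c {β₂} c-path (path-in-full F β₂ β₂-path))

      X Y : Flow G
      X = pathsFlow X-paths
      Y = pathsFlow (extend-path {C} C-path ∷ X-paths)

      X⊆ : ∀ {e} → on X e ≢ 0 → e ∈ₗ p₀ ⊎ e ∈ F.edges ⊎ e ∈ₗ p₁
      X⊆ Xe≢0 with q , q∈ , e∈q ← find (Anyₚ.map⁻ (pathsFlow≢0⁻ X-paths Xe≢0)) =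
        Sum.map₂ (Sum.map₁ (All.lookup (FP.edges-in q (All.lookup Ps-paths q∈)))) (∈-extend⁻ q e∈q)

      4≤cover : ∀ {ps} → IsPathCover (support X) s t ps → 4 ≤ length ps
      4≤cover cover = length-≤-cover (λ A e → IsPath F s′ t′ A × IsPrivateEdge F s′ t′ A e) Ps-unique
        (λ A∈ → let A-path = All.lookup Ps-paths A∈
                    e , e-private = private-edge A-path
                in e , (A-path , e-private) , IsPathCover.covers cover (support⁺ X
                     (pathsFlow≢0⁺ X-paths (Anyₚ.map⁺ (lose A∈
                       (∈-extend⁺ _ (inj₂ (inj₁ (proj₁ e-private)))))))))
        λ { (A-path , A-e) (B-path , B-f) q∈ e∈q f∈q →
            let q-path , q⊆ = support-path⁻ X _ (All.lookup (IsPathCover.paths cover) q∈)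
            in separated F funnel p₀-path p₁-path X⊆ A-path B-path A-e B-f q-path q⊆ e∈q f∈q }

      X-cover : IsPathCover (support X) s t (map extend Ps)
      X-cover = record
        { paths  = All.tabulate λ {q} q∈ → support-path⁺ X q (All.lookup X-paths q∈)
            (All.tabulate λ e∈q → pathsFlow≢0⁺ X-paths (lose q∈ e∈q))
        ; covers = pathsFlow≢0⁻ X-paths ∘ support⁻ X
        }

      Y-paths : All (Path s t) (extend C ∷ map extend Ps)
      Y-paths = extend-path {C} C-path ∷ X-paths

      Qs : List (List (E digraph))
      Qs = extend C ∷ extend A₁ ∷ extend B₁ ∷ []

      Qs⊆ : ∀ {q} → q ∈ₗ Qs → q ∈ₗ extend C ∷ map extend Ps
      Qs⊆ (here eq)                 = here eq
      Qs⊆ (there (here eq))         = there (here eq)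
      Qs⊆ (there (there (here eq))) = there (there (there (here eq)))

      -- `C` contains `α₂` and `β₂`. What remains of `A₂` is `μ`, which lies on `A₁`, and what
      -- remains of `B₂` is `ν`, which lies on `B₁`.
      Qs-covers : ∀ {e} → Any (e ∈ₗ_) (extend C ∷ map extend Ps) → Any (e ∈ₗ_) Qs
      Qs-covers (here e∈)                         = here e∈
      Qs-covers (there (here e∈))                 = there (here e∈)
      Qs-covers (there (there (here e∈))) with ∈-extend⁻ A₂ e∈
      ... | inj₁ e∈p₀         = here (∈-extend⁺ C (inj₁ e∈p₀))
      ... | inj₂ (inj₂ e∈p₁)  = here (∈-extend⁺ C (inj₂ (inj₂ e∈p₁)))
      ... | inj₂ (inj₁ e∈A₂) with ∈-++⁻ α₂ e∈A₂
      ...   | inj₁ e∈α₂ = here (∈-extend⁺ C (inj₂ (inj₁ (∈-++⁺ˡ e∈α₂))))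
      ...   | inj₂ e∈μ  = there (here (∈-extend⁺ A₁ (inj₂ (inj₁ (∈-++⁺ʳ α₁ e∈μ)))))
      Qs-covers (there (there (there (here e∈)))) = there (there (here e∈))
      Qs-covers (there (there (there (there (here e∈))))) with ∈-extend⁻ B₂ e∈
      ... | inj₁ e∈p₀         = here (∈-extend⁺ C (inj₁ e∈p₀))
      ... | inj₂ (inj₂ e∈p₁)  = here (∈-extend⁺ C (inj₂ (inj₂ e∈p₁)))
      ... | inj₂ (inj₁ e∈B₂) with ∈-++⁻ ν e∈B₂
      ...   | inj₁ e∈ν  = there (there (here (∈-extend⁺ B₁ (inj₂ (inj₁ (∈-++⁺ˡ e∈ν))))))
      ...   | inj₂ e∈β₂ = here (∈-extend⁺ C (inj₂ (inj₁ (∈-++⁺ʳ α₂ (∈-++⁺ʳ c e∈β₂)))))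

      Y-cover : IsPathCover (support Y) s t Qs
      Y-cover = record
        { paths  = All.tabulate λ {q} q∈ → support-path⁺ Y q (All.lookup Y-paths (Qs⊆ q∈))
            (All.tabulate λ e∈q → pathsFlow≢0⁺ Y-paths (lose (Qs⊆ q∈) e∈q))
        ; covers = Qs-covers ∘ pathsFlow≢0⁻ Y-paths ∘ support⁻ Y
        }

    unstable : ¬ WidthStable G
    unstable stable = width-exists X-cover λ (w , X-width) → width-exists Y-cover λ (w′ , Y-width) →
      let ps , cover , ∣ps∣≡w = IsWidth.attained X-width
      in ℕ.<⇒≱ (s≤s (IsWidth.minimal Y-width Y-cover))
           (ℕ.≤-trans (ℕ.≤-trans (4≤cover cover) (ℕ.≤-reflexive ∣ps∣≡w))
             -- `Y` is `X` plus the unit flow along `extend C`, so `X ≤ Y`; yet `X` needs four paths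
             -- and `Y` at most three.
             (stable X Y (λ e → ℕ.m≤n+m (on X e) (count (extend C) e)) X-width Y-width))

  central⇒unstable : ∀ (F : Subgraph digraph) {s′ t′ u v c} → IsFunnel F s′ t′ →
    IsMerging F u → IsForking F v → Path u v c → ¬ WidthStable G
  central⇒unstable F {s′} {t′} {u} {v} {c} funnel merging forking c-path =
    let e₁ , e₂ , e₁∈ , e₂∈ , e₁→u , e₂→u , e₁≢e₂ = merging⁻ F merging
        f₁ , f₂ , f₁∈ , f₂∈ , v→f₁ , v→f₂ , f₁≢f₂ = forking⁻ F forking
        a₁ , a₁-path = from-s′ (F.src∈ e₁∈)
        a₂ , a₂-path = from-s′ (F.src∈ e₂∈)
        b₁ , b₁-path = to-t′ (F.tgt∈ f₁∈)
        b₂ , b₂-path = to-t′ (F.tgt∈ f₂∈)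
        μ  , μ-path  = to-t′ (subst (_∈ F.vertices) e₁→u (F.tgt∈ e₁∈))
        ν  , ν-path  = from-s′ (subst (_∈ F.vertices) v→f₁ (F.src∈ f₁∈))
        p₀ , p₀-path = from-source full isSTDAG {s′} ∈⊤
        p₁ , p₁-path = to-sink full isSTDAG {t′} ∈⊤
    in CentralPath.unstable F funnel
         {α₁ = a₁ ∷ʳ e₁} {a₂ ∷ʳ e₂} {μ} {ν} {f₁ ∷ b₁} {f₂ ∷ b₂} {p₀} {p₁} {c}
         (subst (λ x → IsPath F s′ x (a₁ ∷ʳ e₁)) e₁→u (FP.snoc a₁ a₁-path e₁∈ refl))
         (subst (λ x → IsPath F s′ x (a₂ ∷ʳ e₂)) e₂→u (FP.snoc a₂ a₂-path e₂∈ refl))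
         (e₁≢e₂ ∘ ∷ʳ-injectiveʳ a₁ a₂)
         (f₁∈ , v→f₁ , b₁-path) (f₂∈ , v→f₂ , b₂-path) (f₁≢f₂ ∘ ∷-injectiveˡ)
         μ-path ν-path p₀-path p₁-path c-path
    where
    module F = Subgraph F
    module FP = Paths F

    from-s′ : ∀ {v} → v ∈ F.vertices → ∃[ p ] IsPath F s′ v p
    from-s′ = from-source F (IsFunnel.isSTDAG funnel)

    to-t′ : ∀ {v} → v ∈ F.vertices → ∃[ p ] IsPath F v t′ p
    to-t′ = to-sink F (IsFunnel.isSTDAG funnel)

  stable⇒noFunnel : WidthStable G → NoFunnelWithCentralPath G
  stable⇒noFunnel stable (F , (_ , _ , funnel) , _ , _ , _ , merging , forking , c-path) =
    central⇒unstable F funnel merging forking c-path stable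

-- Trees: choosing one edge for each vertex.

module Choice {m n} (end : Fin m → Fin n) {Q : Fin m → Set} (Q? : Decidable Q) where

  pick : Fin n → Maybe (Fin m)
  pick v with any? (λ e → Q? e ×-dec (end e ≟ v))
  ... | yes (e , _) = just e
  ... | no  _       = nothing

  -- The edges picked for their own endpoint. With `end = tgt` every vertex keeps at most one
  -- parent, with `end = src` at most one child.
  Chosen : Fin m → Set
  Chosen e = pick (end e) ≡ just e

  chosen? : Decidable Chosen
  chosen? e = Maybe-≡-dec _≟_ (pick (end e)) (just e)

  chosen⇒ : ∀ {e} → Chosen e → Q e
  chosen⇒ {e} eq with any? (λ f → Q? f ×-dec (end f ≟ end e)) | eq
  ... | yes (_ , Qe , _) | refl = Qe

  chosen-unique : ∀ {e f} → Chosen e → Chosen f → end e ≡ end f → e ≡ f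
  chosen-unique e-chosen f-chosen eq =
    just-injective (trans (sym e-chosen) (trans (cong pick eq) f-chosen))

  chosen-exists : ∀ {e} → Q e → ∃[ f ] Chosen f × end f ≡ end e
  chosen-exists {e} Qe with any? (λ f → Q? f ×-dec (end f ≟ end e)) in eq
  ... | no  none            = contradiction (e , Qe , refl) none
  ... | yes (f , Qf , end≡) = f , trans (cong pick end≡) picked , end≡
    where
    picked : pick (end e) ≡ just f
    picked rewrite eq = refl

-- Without funnels with central paths, flows have heavy paths.

module NoFunnel⇒HeavyPaths (G : STDAG) where
  open STDAG G
  open IsSTDAG isSTDAG using (acyclic)
  open Paths full
  open Acyclic G

  module Cut {Γ : E digraph → Set} (Γ? : Decidable Γ) {A B : V digraph → Set}
    (A? : Decidable A) (B? : Decidable B) (disjoint : ∀ {v} → A v → ¬ B v) (A-s : A s) (B-t : B t)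
    (A-parent : ∀ {v} → A v → v ≢ s → ∃[ e ] Γ e × A (src e) × tgt e ≡ v)
    (B-child  : ∀ {v} → B v → v ≢ t → ∃[ e ] Γ e × B (tgt e) × src e ≡ v) where

    C : E digraph → Set
    C e = Γ e × A (src e) × B (tgt e)

    C? : Decidable C
    C? e = Γ? e ×-dec (A? (src e) ×-dec B? (tgt e))

    module τ = Choice tgt (λ e → Γ? e ×-dec (A? (src e) ×-dec A? (tgt e)))
    module σ = Choice src (λ e → Γ? e ×-dec (B? (src e) ×-dec B? (tgt e)))

    τ σ : E digraph → Set
    τ = τ.Chosen
    σ = σ.Chosen

    τ-parent : ∀ {v} → A v → v ≢ s → ∃[ e ] τ e × A (src e) × tgt e ≡ v
    τ-parent Av v≢s with e , Γe , Asrc , refl ← A-parent Av v≢s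
      with f , τf , eq ← τ.chosen-exists (Γe , Asrc , Av) =
      f , τf , proj₁ (proj₂ (τ.chosen⇒ τf)) , eq

    σ-child : ∀ {v} → B v → v ≢ t → ∃[ e ] σ e × B (tgt e) × src e ≡ v
    σ-child Bv v≢t with e , Γe , Btgt , refl ← B-child Bv v≢t
      with f , σf , eq ← σ.chosen-exists (Γe , Bv , Btgt) =
      f , σf , proj₂ (proj₂ (σ.chosen⇒ σf)) , eq

    τ-from-s : ∀ {v} → A v → Reach τ s v
    τ-from-s = backward-walk s τ-parent

    σ-to-t : ∀ {v} → B v → Reach σ v t
    σ-to-t = forward-walk t σ-child

    -- Read from its end, a `τ`-path is forced edge by edge, since a vertex has at most one chosen
    -- parent; hence the reversed view of lists. It can stop only at `s`, which has no in-edge.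
    τ-path-unique : ∀ {v} p q → Path s v p → All τ p → Path s v q → All τ q → p ≡ q
    τ-path-unique p q = go (reverseView p) (reverseView q)
      where
      go : ∀ {v p q} → Reverse p → Reverse q → Path s v p → All τ p → Path s v q → All τ q → p ≡ q
      go [] [] _ _ _ _ = refl
      go [] (q ∶ _ ∶ʳ f) (refl , _) _ q-path _ =
        contradiction (proj₁ (proj₂ (unsnoc q q-path))) no-in-edge
      go (p ∶ _ ∶ʳ e) [] p-path _ (refl , _) _ =
        contradiction (proj₁ (proj₂ (unsnoc p p-path))) no-in-edge
      go (p ∶ rp ∶ʳ e) (q ∶ rq ∶ʳ f) p-path p⊆ q-path q⊆
        with p′ , e→v , _ ← unsnoc p p-path | q′ , f→v , _ ← unsnoc q q-path
           | p⊆′ , τe ← ∷ʳ⁻ p⊆ | q⊆′ , τf ← ∷ʳ⁻ q⊆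
        with refl ← τ.chosen-unique τe τf (trans e→v (sym f→v))
           = cong (_∷ʳ e) (go rp rq p′ p⊆′ q′ q⊆′)

    σ-path-unique : ∀ {v} p q → Path v t p → All σ p → Path v t q → All σ q → p ≡ q
    σ-path-unique []      []      _ _ _ _ = refl
    σ-path-unique []      (f ∷ q) (refl , _) _ (_ , src≡t , _) _ = contradiction src≡t no-out-edge
    σ-path-unique (e ∷ p) []      (_ , src≡t , _) _ (refl , _) _ = contradiction src≡t no-out-edge
    σ-path-unique (e ∷ p) (f ∷ q) (_ , v→e , p-path) (σe ∷ p⊆) (_ , v→f , q-path) (σf ∷ q⊆)
      with refl ← σ.chosen-unique σe σf (trans v→e (sym v→f)) =
      cong (e ∷_) (σ-path-unique p q p-path p⊆ q-path q⊆)

    -- F is the union of the edges of C with the τ-paths into them and the σ-paths out of them.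
    Below Above : V digraph → Set
    Below v = ∃[ c ] C c × Reach τ v (src c)
    Above v = ∃[ c ] C c × Reach σ (tgt c) v

    below? : Decidable Below
    below? v = any? λ c → C? c ×-dec reach? τ.chosen? v (src c)

    above? : Decidable Above
    above? v = any? λ c → C? c ×-dec reach? σ.chosen? (tgt c) v

    InF : E digraph → Set
    InF e = C e ⊎ (τ e × Below (tgt e)) ⊎ (σ e × Above (src e))

    inF? : Decidable InF
    inF? e = C? e ⊎-dec ((τ.chosen? e ×-dec below? (tgt e)) ⊎-dec (σ.chosen? e ×-dec above? (src e)))

    VertexInF : V digraph → Set
    VertexInF v = (A v × Below v) ⊎ (B v × Above v)

    vertexInF? : Decidable VertexInF
    vertexInF? v = (A? v ×-dec below? v) ⊎-dec (B? v ×-dec above? v)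

    src-inF : ∀ {e} → InF e → VertexInF (src e)
    src-inF {e} (inj₁ c@(_ , Asrc , _)) = inj₁ (Asrc , e , c , reach-refl)
    src-inF (inj₂ (inj₁ (τe , c , Cc , r))) = inj₁ (proj₁ (proj₂ (τ.chosen⇒ τe)) , c , Cc , reach-step τe r)
    src-inF (inj₂ (inj₂ (σe , above)))      = inj₂ (proj₁ (proj₂ (σ.chosen⇒ σe)) , above)

    tgt-inF : ∀ {e} → InF e → VertexInF (tgt e)
    tgt-inF {e} (inj₁ c@(_ , _ , Btgt)) = inj₂ (Btgt , e , c , reach-refl)
    tgt-inF (inj₂ (inj₁ (τe , below)))      = inj₁ (proj₂ (proj₂ (τ.chosen⇒ τe)) , below)
    tgt-inF (inj₂ (inj₂ (σe , c , Cc , r))) = inj₂ (proj₂ (proj₂ (σ.chosen⇒ σe)) , c , Cc , reach-snoc r σe)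

    F : Subgraph digraph
    F = record
      { vertices = tabulate (does ∘ vertexInF?)
      ; edges    = tabulate (does ∘ inF?)
      ; src∈     = ∈-comprehension⁺ vertexInF? ∘ src-inF ∘ ∈-comprehension⁻ inF?
      ; tgt∈     = ∈-comprehension⁺ vertexInF? ∘ tgt-inF ∘ ∈-comprehension⁻ inF?
      }

    edge⁺ : ∀ {e} → InF e → e ∈ Subgraph.edges F
    edge⁺ = ∈-comprehension⁺ inF?

    edge⁻ : ∀ {e} → e ∈ Subgraph.edges F → InF e
    edge⁻ = ∈-comprehension⁻ inF?

    -- An edge of `C` puts `s` and `t` into `F`. Any other vertex of `F` has an in-edge and an
    -- out-edge in `F`: a tree edge, or an edge of `C` at the border between `A` and `B`.
    F-isSTDAG : ∃[ c ] C c → IsSTDAG F s t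
    F-isSTDAG (c , Cc@(_ , Asrc , Btgt)) = record
      { acyclic       = λ {v} {p} path → acyclic {p = p} (path-in-full F p path)
      ; source        = ∈-comprehension⁺ vertexInF? (inj₁ (A-s , c , Cc , τ-from-s Asrc))
                        , λ _ → no-in-edge
      ; source-unique = λ {v} (v∈ , no-in) → decidable-stable (v ≟ s) λ v≢s →
          let e , e∈ , eq = in-F v≢s (∈-comprehension⁻ vertexInF? v∈) in no-in (edge⁺ e∈) eq
      ; sink          = ∈-comprehension⁺ vertexInF? (inj₂ (B-t , c , Cc , σ-to-t Btgt))
                        , λ _ → no-out-edge
      ; sink-unique   = λ {v} (v∈ , no-out) → decidable-stable (v ≟ t) λ v≢t →
          let e , e∈ , eq = out-F v≢t (∈-comprehension⁻ vertexInF? v∈) in no-out (edge⁺ e∈) eq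
      }
      where
      in-F : ∀ {v} → v ≢ s → VertexInF v → ∃[ e ] InF e × tgt e ≡ v
      in-F v≢s (inj₁ (Av , below)) with e , τe , _ , refl ← τ-parent Av v≢s =
        e , inj₂ (inj₁ (τe , below)) , refl
      in-F v≢s (inj₂ (Bv , c , Cc , r)) with reach-last r
      ... | inj₁ eq                 = c , inj₁ Cc , eq
      ... | inj₂ (e , σe , eq , r′) = e , inj₂ (inj₂ (σe , c , Cc , r′)) , eq

      out-F : ∀ {v} → v ≢ t → VertexInF v → ∃[ e ] InF e × src e ≡ v
      out-F v≢t (inj₁ (Av , c , Cc , r)) with reach-first r
      ... | inj₁ eq                 = c , inj₁ Cc , sym eq
      ... | inj₂ (e , τe , eq , r′) = e , inj₂ (inj₁ (τe , c , Cc , r′)) , eq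
      out-F v≢t (inj₂ (Bv , above)) with e , σe , _ , refl ← σ-child Bv v≢t =
        e , inj₂ (inj₂ (σe , above)) , refl

    inF-tgt-A : ∀ {e} → InF e → A (tgt e) → τ e
    inF-tgt-A (inj₁ (_ , _ , Btgt))  Atgt = contradiction Btgt (disjoint Atgt)
    inF-tgt-A (inj₂ (inj₁ (τe , _))) _    = τe
    inF-tgt-A (inj₂ (inj₂ (σe , _))) Atgt = contradiction (proj₂ (proj₂ (σ.chosen⇒ σe))) (disjoint Atgt)

    inF-src-B : ∀ {e} → InF e → B (src e) → σ e
    inF-src-B (inj₁ (_ , Asrc , _))  Bsrc = contradiction Bsrc (disjoint Asrc)
    inF-src-B (inj₂ (inj₁ (τe , _))) Bsrc = contradiction Bsrc (disjoint (proj₁ (proj₂ (τ.chosen⇒ τe))))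
    inF-src-B (inj₂ (inj₂ (σe , _))) _    = σe

    -- An edge of `F` with head in `A` belongs to `τ` and starts in `A`, so `F` never returns from
    -- `B` to `A`.
    path-to-A : ∀ {u v} p → IsPath F u v p → A v → A u × All τ p
    path-to-A []      (refl , _)       Av = Av , []
    path-to-A (e ∷ p) (e∈ , refl , path) Av with Atgt , p⊆ ← path-to-A p path Av
      with τe ← inF-tgt-A (edge⁻ e∈) Atgt = proj₁ (proj₂ (τ.chosen⇒ τe)) , τe ∷ p⊆

    path-from-B : ∀ {u v} p → IsPath F u v p → B u → All σ p
    path-from-B []      _                  Bu = []
    path-from-B (e ∷ p) (e∈ , refl , path) Bu with σe ← inF-src-B (edge⁻ e∈) Bu =
      σe ∷ path-from-B p path (proj₂ (proj₂ (σ.chosen⇒ σe)))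

    path-crosses : ∀ {u v} p → IsPath F u v p → A u → B v → ∃[ c ] c ∈ₗ p × C c
    path-crosses []      (refl , _)         Au Bv = contradiction Bv (disjoint Au)
    path-crosses (e ∷ p) (e∈ , refl , path) Au Bv with edge⁻ e∈
    ... | inj₁ Ce               = e , here refl , Ce
    ... | inj₂ (inj₂ (σe , _)) = contradiction (proj₁ (proj₂ (σ.chosen⇒ σe))) (disjoint Au)
    ... | inj₂ (inj₁ (τe , _))
      with c , c∈ , Cc ← path-crosses p path (proj₂ (proj₂ (τ.chosen⇒ τe))) Bv = c , there c∈ , Cc

    -- The part before `c` is the unique `τ`-path to its tail and the part after `c` the unique
    -- `σ`-path from its head. So an edge of `C` is private to the path through it.
    path-through-unique : ∀ {c p q} → C c → IsPath F s t p → IsPath F s t q → c ∈ₗ p → c ∈ₗ q → p ≡ q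
    path-through-unique {c} {p} {q} (_ , Asrc , Btgt) p-path q-path c∈p c∈q =
      let p₁ , p₂ , p≡ , p₁-path , p₂-path = Paths.split-∈ F p-path c∈p
          q₁ , q₂ , q≡ , q₁-path , q₂-path = Paths.split-∈ F q-path c∈q
          eq₁ = τ-path-unique p₁ q₁ (path-in-full F p₁ p₁-path) (proj₂ (path-to-A p₁ p₁-path Asrc))
                                    (path-in-full F q₁ q₁-path) (proj₂ (path-to-A q₁ q₁-path Asrc))
          eq₂ = σ-path-unique p₂ q₂ (path-in-full F p₂ p₂-path) (path-from-B p₂ p₂-path Btgt)
                                    (path-in-full F q₂ q₂-path) (path-from-B q₂ q₂-path Btgt)
      in trans p≡ (trans (cong₂ (λ a b → a ++ c ∷ b) eq₁ eq₂) (sym q≡))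

    F-isFunnel : ∃[ c ] C c → IsFunnel F s t
    F-isFunnel some = record
      { isSTDAG      = F-isSTDAG some
      ; private-edge = λ {p} p-path →
          let c , c∈p , Cc = path-crosses p p-path A-s B-t
          in c , c∈p , λ {q} q-path q≢p c∈q →
               q≢p (path-through-unique {c} {q} {p} Cc q-path p-path c∈q c∈p)
      }

    TwoAbove TwoBelow : V digraph → Set
    TwoAbove x = ∃[ c ] ∃[ d ] C c × C d × c ≢ d × Reach σ (tgt c) x × Reach σ (tgt d) x
    TwoBelow y = ∃[ c ] ∃[ d ] C c × C d × c ≢ d × Reach τ y (src c) × Reach τ y (src d)

    twoAbove? : Decidable TwoAbove
    twoAbove? x = any? λ c → any? λ d → C? c ×-dec (C? d ×-dec (¬? (c ≟ d) ×-dec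
      (reach? σ.chosen? (tgt c) x ×-dec reach? σ.chosen? (tgt d) x)))

    -- Two `σ`-paths lead to `x` from different edges of `C`. Followed backwards from `x` they share
    -- edges for a while, and where they part, two edges of `F` meet.
    merging-before : ∀ {x} → TwoAbove x → ∃[ u ] ∃[ p ] IsMerging F u × Path u x p
    merging-before {x} = go (⊏-wellFounded x)
      where
      go : ∀ {x} → Acc _⊏_ x → TwoAbove x → ∃[ u ] ∃[ p ] IsMerging F u × Path u x p
      go {x} (acc rs) (c , d , Cc , Cd , c≢d , r , r′) with reach-last r | reach-last r′
      ... | inj₁ eq | inj₁ eq′ =
        x , [] , merging⁺ F (edge⁺ (inj₁ Cc)) (edge⁺ (inj₁ Cd)) eq eq′ c≢d , refl , ∈⊤
      -- The two edges differ because an edge of `C` starts in `A` and an edge of `σ` in `B`.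
      ... | inj₁ eq | inj₂ (f , σf , eq′ , q′) =
        x , [] , merging⁺ F (edge⁺ (inj₁ Cc)) (edge⁺ (inj₂ (inj₂ (σf , d , Cd , q′)))) eq eq′
          (λ { refl → disjoint (proj₁ (proj₂ Cc)) (proj₁ (proj₂ (σ.chosen⇒ σf))) }) , refl , ∈⊤
      ... | inj₂ (e , σe , eq , q) | inj₁ eq′ =
        x , [] , merging⁺ F (edge⁺ (inj₂ (inj₂ (σe , c , Cc , q)))) (edge⁺ (inj₁ Cd)) eq eq′
          (λ { refl → disjoint (proj₁ (proj₂ Cd)) (proj₁ (proj₂ (σ.chosen⇒ σe))) }) , refl , ∈⊤
      ... | inj₂ (e , σe , eq , q) | inj₂ (f , σf , eq′ , q′) with e ≟ f
      ...   | no e≢f =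
        x , [] , merging⁺ F (edge⁺ (inj₂ (inj₂ (σe , c , Cc , q))))
                            (edge⁺ (inj₂ (inj₂ (σf , d , Cd , q′)))) eq eq′ e≢f , refl , ∈⊤
      ...   | yes refl
        with u , p , merging , path ←
               go (rs (subst (src e ⊏_) eq (edge-⊏ e))) (c , d , Cc , Cd , c≢d , q , q′)
           = u , p ∷ʳ e , merging , subst (λ x → Path u x (p ∷ʳ e)) eq (snoc p path ∈⊤ refl)

    forking-after : ∀ {y} → TwoBelow y → ∃[ v ] ∃[ p ] IsForking F v × Path y v p
    forking-after {y} = go (⊏-noetherian y)
      where
      go : ∀ {y} → Acc (flip _⊏_) y → TwoBelow y → ∃[ v ] ∃[ p ] IsForking F v × Path y v p
      go {y} (acc rs) (c , d , Cc , Cd , c≢d , r , r′) with reach-first r | reach-first r′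
      ... | inj₁ eq | inj₁ eq′ =
        y , [] , forking⁺ F (edge⁺ (inj₁ Cc)) (edge⁺ (inj₁ Cd)) (sym eq) (sym eq′) c≢d , refl , ∈⊤
      ... | inj₁ eq | inj₂ (f , τf , eq′ , q′) =
        y , [] , forking⁺ F (edge⁺ (inj₁ Cc)) (edge⁺ (inj₂ (inj₁ (τf , d , Cd , q′)))) (sym eq) eq′
          (λ { refl → disjoint (proj₂ (proj₂ (τ.chosen⇒ τf))) (proj₂ (proj₂ Cc)) }) , refl , ∈⊤
      ... | inj₂ (e , τe , eq , q) | inj₁ eq′ =
        y , [] , forking⁺ F (edge⁺ (inj₂ (inj₁ (τe , c , Cc , q)))) (edge⁺ (inj₁ Cd)) eq (sym eq′)
          (λ { refl → disjoint (proj₂ (proj₂ (τ.chosen⇒ τe))) (proj₂ (proj₂ Cd)) }) , refl , ∈⊤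
      ... | inj₂ (e , τe , eq , q) | inj₂ (f , τf , eq′ , q′) with e ≟ f
      ...   | no e≢f =
        y , [] , forking⁺ F (edge⁺ (inj₂ (inj₁ (τe , c , Cc , q))))
                            (edge⁺ (inj₂ (inj₁ (τf , d , Cd , q′)))) eq eq′ e≢f , refl , ∈⊤
      ...   | yes refl
        with v , p , forking , path ←
               go (rs (subst (_⊏ tgt e) eq (edge-⊏ e))) (c , d , Cc , Cd , c≢d , q , q′)
           = v , e ∷ p , forking , ∈⊤ , eq , path

    no-central-path : NoFunnelWithCentralPath G → ∀ {x y p} → TwoAbove x → TwoBelow y → ¬ Path x y p
    no-central-path noFunnel {p = p} above@(c , _ , Cc , _) below path =
      let u , q , merging , q-path = merging-before above
          v , r , forking , r-path = forking-after below
      in noFunnel (F , (s , t , F-isFunnel (c , Cc)) , u , v , q ++ p ++ r , merging , forking ,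
                   concat q {p ++ r} q-path (concat p {r} path r-path))

    -- Shifting A past the vertices of U and B past those of D turns C into an antichain Φ of Γ.
    module Shift (noFunnel : NoFunnelWithCentralPath G) where

      -- `D` is the part of `A` reached from branching vertices of `B`, and passes to the far side.
      -- `U` is the part of `B` that can still return to the rest of `A`, and passes to the near
      -- side.
      D U : V digraph → Set
      D y = A y × ∃[ x ] TwoAbove x × Reach Γ x y
      U x = B x × ∃[ y ] (A y × ¬ D y) × Reach Γ x y

      D? : Decidable D
      D? y = A? y ×-dec any? λ x → twoAbove? x ×-dec reach? Γ? x y

      U? : Decidable U
      U? x = B? x ×-dec any? λ y → (A? y ×-dec ¬? (D? y)) ×-dec reach? Γ? x y

      -- Two edges of `C` below `y` would make `y` branching, and `y` is reached from a branching
      -- vertex of `B`: a central path.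
      D-branch-unique : ∀ {y c d} → D y → C c → C d → Reach τ y (src c) → Reach τ y (src d) → c ≡ d
      D-branch-unique {c = c} {d} (_ , _ , above , p , p-path , _) Cc Cd r r′ =
        decidable-stable (c ≟ d) λ c≢d →
          no-central-path noFunnel {p = p} above (c , d , Cc , Cd , c≢d , r , r′) p-path

      -- A branching `x` would put into `D` the very vertex outside `D` whose reachability from `x`
      -- places `x` in `U`.
      U-branch-unique : ∀ {x c d} → U x → C c → C d → Reach σ (tgt c) x → Reach σ (tgt d) x → c ≡ d
      U-branch-unique {x} {c} {d} (_ , y , (Ay , ¬Dy) , xy) Cc Cd r r′ =
        decidable-stable (c ≟ d) λ c≢d → ¬Dy (Ay , x , (c , d , Cc , Cd , c≢d , r , r′) , xy)

      s∉D : ¬ D s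
      s∉D (_ , x , (_ , _ , Cc , _ , _ , r , _) , xs) with reach-last xs
      ... | inj₂ (_ , _ , into-s , _) = no-in-edge into-s
      ... | inj₁ refl with reach-last r
      ...   | inj₁ into-s                = no-in-edge into-s
      ...   | inj₂ (_ , _ , into-s , _) = no-in-edge into-s

      t∉U : ¬ U t
      t∉U (_ , y , (Ay , _) , ty) with reach-first ty
      ... | inj₁ refl                 = disjoint Ay B-t
      ... | inj₂ (_ , _ , out-t , _) = no-out-edge out-t

      Near Far : V digraph → Set
      Near v = (A v × ¬ D v) ⊎ U v
      Far  v = D v ⊎ (B v × ¬ U v)

      -- Prolonged by the walks that witness membership in `D` or `U`, a return would put a vertex
      -- of `B` into `U` or a vertex of `A` into `D`, against the choice of sides.
      no-return : ∀ {u v} → Far u → Near v → ¬ Reach Γ u v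
      no-return (inj₂ (Bu , ¬Uu)) (inj₁ near) uv = ¬Uu (Bu , _ , near , uv)
      no-return (inj₂ (Bu , ¬Uu)) (inj₂ (_ , y , near , vy)) uv = ¬Uu (Bu , y , near , reach-trans uv vy)
      no-return (inj₁ (_ , x , above , xu)) (inj₁ (Av , ¬Dv)) uv = ¬Dv (Av , x , above , reach-trans xu uv)
      no-return (inj₁ (_ , x , above , xu)) (inj₂ (_ , y , (Ay , ¬Dy) , vy)) uv =
        ¬Dy (Ay , x , above , reach-trans xu (reach-trans uv vy))

      -- The edges that may replace `c` in the shifted cut: the `τ`-edge entering `D` before `c`,
      -- the `σ`-edge leaving `U` after `c`, or `c` itself.
      data Φ (c : E digraph) : E digraph → Set where
        entering : ∀ {e} → C c → τ e → ¬ D (src e) → D (tgt e) → Reach τ (tgt e) (src c) → Φ c e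
        leaving  : ∀ {e} → C c → σ e → U (src e) → ¬ U (tgt e) → Reach σ (tgt c) (src e) → Φ c e
        staying  : C c → ¬ D (src c) → ¬ U (tgt c) → Φ c c

      -- As `s` lies outside `D` and `t` outside `U`, the tree path from `s` to `c` enters `D` if
      -- the tail of `c` is there, and the one from `c` to `t` leaves `U` if the head is there.
      Φ-exists : ∀ {c} → C c → ∃[ e ] Φ c e
      Φ-exists {c} Cc@(_ , Asrc , Btgt) with D? (src c) | U? (tgt c)
      ... | no ¬Dc | no ¬Uc = c , staying Cc ¬Dc ¬Uc
      ... | yes Dc | _
        with e , τe , ¬Dsrc , ¬¬Dtgt , _ , r ← crossing (¬? ∘ D?) s∉D (λ ¬Dc → ¬Dc Dc) (τ-from-s Asrc)
           = e , entering Cc τe ¬Dsrc (decidable-stable (D? _) ¬¬Dtgt) r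
      ... | no _   | yes Uc
        with e , σe , Usrc , ¬Utgt , r , _ ← crossing U? Uc t∉U (σ-to-t Btgt)
           = e , leaving Cc σe Usrc ¬Utgt r

      Φ⇒Γ : ∀ {c e} → Φ c e → Γ e
      Φ⇒Γ (entering _ τe _ _ _) = proj₁ (τ.chosen⇒ τe)
      Φ⇒Γ (leaving _ σe _ _ _)  = proj₁ (σ.chosen⇒ σe)
      Φ⇒Γ (staying Cc _ _)      = proj₁ Cc

      Φ-near : ∀ {c e} → Φ c e → Near (src e)
      Φ-near (entering _ τe ¬Dsrc _ _) = inj₁ (proj₁ (proj₂ (τ.chosen⇒ τe)) , ¬Dsrc)
      Φ-near (leaving _ _ Usrc _ _)    = inj₂ Usrc
      Φ-near (staying Cc ¬Dsrc _)      = inj₁ (proj₁ (proj₂ Cc) , ¬Dsrc)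

      Φ-far : ∀ {c e} → Φ c e → Far (tgt e)
      Φ-far (entering _ _ _ Dtgt _)  = inj₁ Dtgt
      Φ-far (leaving _ σe _ ¬Utgt _) = inj₂ (proj₂ (proj₂ (σ.chosen⇒ σe)) , ¬Utgt)
      Φ-far (staying Cc _ ¬Utgt)     = inj₂ (proj₂ (proj₂ Cc) , ¬Utgt)

      -- Replacements of the same kind are told apart by uniqueness of branches in `D` and `U`.
      -- Those of different kinds never coincide: `τ` stays in `A`, `σ` stays in `B`, and `C` goes
      -- from `A` to `B`.
      Φ-injective : ∀ {c d e} → Φ c e → Φ d e → c ≡ d
      Φ-injective (entering Cc _ _ Dtgt r) (entering Cd _ _ _ r′) = D-branch-unique Dtgt Cc Cd r r′
      Φ-injective (leaving Cc _ Usrc _ r)  (leaving Cd _ _ _ r′)  = U-branch-unique Usrc Cc Cd r r′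
      Φ-injective (staying _ _ _)          (staying _ _ _)        = refl
      Φ-injective (entering _ τe _ _ _) (leaving _ σe _ _ _) =
        contradiction (proj₁ (proj₂ (σ.chosen⇒ σe))) (disjoint (proj₁ (proj₂ (τ.chosen⇒ τe))))
      Φ-injective (leaving _ σe _ _ _) (entering _ τe _ _ _) =
        contradiction (proj₁ (proj₂ (σ.chosen⇒ σe))) (disjoint (proj₁ (proj₂ (τ.chosen⇒ τe))))
      Φ-injective (entering _ τe _ _ _) (staying Cd _ _) =
        contradiction (proj₂ (proj₂ Cd)) (disjoint (proj₂ (proj₂ (τ.chosen⇒ τe))))
      Φ-injective (staying Cc _ _) (entering _ τe _ _ _) =
        contradiction (proj₂ (proj₂ Cc)) (disjoint (proj₂ (proj₂ (τ.chosen⇒ τe))))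
      Φ-injective (leaving _ σe _ _ _) (staying Cd _ _) =
        contradiction (proj₁ (proj₂ (σ.chosen⇒ σe))) (disjoint (proj₁ (proj₂ Cd)))
      Φ-injective (staying Cc _ _) (leaving _ σe _ _ _) =
        contradiction (proj₁ (proj₂ (σ.chosen⇒ σe))) (disjoint (proj₁ (proj₂ Cc)))

      -- Replacement edges run from near to far, so a second one further along a path would require
      -- a return.
      Φ-antichain : ∀ {c d e f u v q} → Φ c e → Φ d f → Path u v q → All Γ q → e ∈ₗ q → f ∈ₗ q → c ≡ d
      Φ-antichain Φe Φf path q⊆ e∈q f∈q with order path q⊆ e∈q f∈q
      ... | inj₁ refl      = Φ-injective Φe Φf
      ... | inj₂ (inj₁ ef) = contradiction ef (no-return (Φ-far Φe) (Φ-near Φf))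
      ... | inj₂ (inj₂ fe) = contradiction fe (no-return (Φ-far Φf) (Φ-near Φe))

      cut≤cover : ∀ {ps} → (∀ {p} → p ∈ₗ ps → Path s t p × All Γ p) → (∀ {e} → Γ e → Any (e ∈ₗ_) ps) →
        length (filter C? (allFin _)) ≤ length ps
      cut≤cover paths covers = length-≤-cover Φ (filter⁺ C? (allFin⁺ _))
        (λ c∈ → let e , Φe = Φ-exists (proj₂ (∈-filter⁻ C? {xs = allFin _} c∈))
                in e , Φe , covers (Φ⇒Γ Φe))
        (λ {_} {_} {_} {_} {p} Φe Φf p∈ →
          Φ-antichain {q = p} Φe Φf (proj₁ (paths p∈)) (proj₂ (paths p∈)))

  open Flow
  open Flows G
  open HeavyPaths G using (HasHeavyPath; HasHeavyPaths)

  -- The cut of light edges when heavy edges do not reach the sink.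

  module Threshold (X : Flow G) (X≢0 : IsNonZero X) (w : ℕ) where

    Γ Heavy : E digraph → Set
    Γ e     = on X e ≢ 0
    Heavy e = ∣ X ∣ ≤ w * on X e

    Γ? : Decidable Γ
    Γ? e = ¬? (on X e ℕ.≟ 0)

    heavy? : Decidable Heavy
    heavy? e = ∣ X ∣ ≤? w * on X e

    heavy⇒Γ : ∀ {e} → Heavy e → Γ e
    heavy⇒Γ heavy Xe≡0 = value≢0 X X≢0 (ℕ.n≤0⇒n≡0
      (ℕ.≤-trans heavy (ℕ.≤-reflexive (trans (cong (w *_) Xe≡0) (ℕ.*-zeroʳ w)))))

    -- `B` is built first, from routes to `t` whose edges start outside `S`; then `A`, from routes
    -- out of `s` that never enter `B`. Thus an edge of the support leaving `A` can only end in `B`.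
    S B A : V digraph → Set
    S v = Reach Heavy s v
    S? : Decidable S
    S? = reach? heavy? s
    B v = Reach (λ e → Γ e × ¬ S (src e)) v t
    B? : Decidable B
    B? v = reach? (λ e → Γ? e ×-dec ¬? (S? (src e))) v t
    A v = Reach (λ e → Γ e × ¬ B (tgt e)) s v
    A? : Decidable A
    A? = reach? (λ e → Γ? e ×-dec ¬? (B? (tgt e))) s

    heavy-path : S t → HasHeavyPath X w
    heavy-path (p , path , p⊆) =
      p , support-path⁺ X p path (All.map heavy⇒Γ p⊆) , All.lookup p⊆

    module _ (t∉S : ¬ S t) where

      B⇒¬S : ∀ {v} → B v → ¬ S v
      B⇒¬S Bv Sv with reach-first Bv
      ... | inj₁ refl                       = t∉S Sv
      ... | inj₂ (_ , (_ , ¬Ssrc) , refl , _) = ¬Ssrc Sv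

      disjoint : ∀ {v} → A v → ¬ B v
      disjoint Av Bv with reach-last Av
      ... | inj₁ refl                       = B⇒¬S Bv reach-refl
      ... | inj₂ (_ , (_ , ¬Btgt) , refl , _) = ¬Btgt Bv

      A-parent : ∀ {v} → A v → v ≢ s → ∃[ e ] Γ e × A (src e) × tgt e ≡ v
      A-parent Av v≢s with reach-last Av
      ... | inj₁ s≡v                     = contradiction (sym s≡v) v≢s
      ... | inj₂ (e , (Γe , _) , eq , r) = e , Γe , r , eq

      B-child : ∀ {v} → B v → v ≢ t → ∃[ e ] Γ e × B (tgt e) × src e ≡ v
      B-child Bv v≢t with reach-first Bv
      ... | inj₁ v≡t                     = contradiction v≡t v≢t
      ... | inj₂ (e , (Γe , _) , eq , r) = e , Γe , r , eq

      module X-Cut = Cut Γ? A? B? disjoint reach-refl reach-refl A-parent B-child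
      open X-Cut using (C; C?)

      Cs : List (E digraph)
      Cs = filter C? (allFin _)

      leaves-into-B : ∀ {e} → Γ e → A (src e) → ¬ A (tgt e) → C e
      leaves-into-B {e} Γe Asrc ¬Atgt =
        Γe , Asrc , decidable-stable (B? (tgt e)) λ ¬Btgt → ¬Atgt (reach-snoc Asrc (Γe , ¬Btgt))

      -- The head of `e` is in `B`, hence outside `S`. Were `e` heavy, its tail would be outside `S`
      -- too and so belong to `B`, although it belongs to `A`.
      light : ∀ {e} → C e → w * on X e < ∣ X ∣
      light {e} (Γe , Asrc , Btgt) = ℕ.≰⇒> λ heavy → disjoint Asrc
        (reach-step (Γe , λ Ssrc → B⇒¬S Btgt (reach-snoc Ssrc heavy)) Btgt)

      ∣X∣≤Cs : ∣ X ∣ ≤ ∑ Cs (on X)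
      ∣X∣≤Cs = value≤cut X A? reach-refl (λ At → disjoint At reach-refl) C? leaves-into-B

      -- Lightness over ℕ reads `1 + w * on X e ≤ ∣ X ∣`. Summed over the cut it gives `length Cs +
      -- w * ∣ X ∣ ≤ length Cs * ∣ X ∣`, so `length Cs ≤ w` would leave the cut empty and the value
      -- 0.
      w<∣Cs∣ : w < length Cs
      w<∣Cs∣ = ℕ.≰⇒> λ ∣Cs∣≤w → value≢0 X X≢0 (ℕ.n≤0⇒n≡0
        (ℕ.≤-trans ∣X∣≤Cs (ℕ.≤-reflexive (cong (λ xs → ∑ xs (on X)) (length≡0 Cs (Cs-empty ∣Cs∣≤w))))))
        where
        open ℕ.≤-Reasoning

        length≡0 : ∀ (xs : List (E digraph)) → length xs ≤ 0 → xs ≡ []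
        length≡0 [] _ = refl

        Cs-empty : length Cs ≤ w → length Cs ≤ 0
        Cs-empty ∣Cs∣≤w = ℕ.+-cancelʳ-≤ (w * ∣ X ∣) _ _ (begin
          length Cs + w * ∣ X ∣                       ≤⟨ ℕ.+-monoʳ-≤ (length Cs) (ℕ.*-monoʳ-≤ w ∣X∣≤Cs) ⟩
          length Cs + w * ∑ Cs (on X)                 ≡⟨ cong₂ _+_ (ℕ.*-identityʳ (length Cs))
                                                            (∑-*ˡ Cs w (on X)) ⟨
          length Cs * 1 + ∑ Cs (λ e → w * on X e)     ≡⟨ cong (_+ ∑ Cs (λ e → w * on X e)) (∑-const Cs 1) ⟨
          ∑ Cs (λ _ → 1) + ∑ Cs (λ e → w * on X e)    ≡⟨ ∑-+ Cs (λ _ → 1) (λ e → w * on X e) ⟨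
          ∑ Cs (λ e → 1 + w * on X e)                 ≤⟨ ∑-mono Cs (λ c∈ →
                                                              light (proj₂ (∈-filter⁻ C? {xs = allFin _} c∈))) ⟩
          ∑ Cs (λ _ → ∣ X ∣)                          ≡⟨ ∑-const Cs ∣ X ∣ ⟩
          length Cs * ∣ X ∣                           ≤⟨ ℕ.*-monoˡ-≤ ∣ X ∣ ∣Cs∣≤w ⟩
          0 + w * ∣ X ∣                               ∎)

      t-unreachable-absurd : NoFunnelWithCentralPath G → ∀ {ps} →
        IsPathCover (support X) s t ps → length ps ≡ w → ⊥
      t-unreachable-absurd noFunnel {ps} cover refl = ℕ.<⇒≱ w<∣Cs∣
        (X-Cut.Shift.cut≤cover noFunnel
          (λ {p} p∈ → support-path⁻ X p (All.lookup (IsPathCover.paths cover) p∈))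
          (IsPathCover.covers cover ∘ support⁺ X))

  noFunnel⇒heavyPaths : NoFunnelWithCentralPath G → HasHeavyPaths
  noFunnel⇒heavyPaths noFunnel X X≢0 {w} width = let open Threshold X X≢0 w in case S? t of λ where
    (yes St) → heavy-path St
    (no ¬St) → let ps , cover , ∣ps∣≡w = IsWidth.attained width
               in contradiction ∣ps∣≡w (t-unreachable-absurd ¬St noFunnel cover)

lemma13 : (G : STDAG) →
    (WidthStable G ⇔ HasPathsOfLargeWeight G) ×
    (HasPathsOfLargeWeight G ⇔ NoFunnelWithCentralPath G)
-- Both equivalences come from the cycle (1) ⇒ (3) ⇒ (2) ⇒ (1).
lemma13 G = mk⇔ (3⇒2 ∘ stable⇒noFunnel) 2⇒1 , mk⇔ (stable⇒noFunnel ∘ 2⇒1) 3⇒2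
  where
  open HeavyPaths G
  open HeavyPaths⇒Stable G
  open Stable⇒NoFunnel G
  open NoFunnel⇒HeavyPaths G

  2⇒1 : HasPathsOfLargeWeight G → WidthStable G
  2⇒1 large = heavyPaths⇒stable (largeWeight⁻ large)

  3⇒2 : NoFunnelWithCentralPath G → HasPathsOfLargeWeight G
  3⇒2 noFunnel = largeWeight⁺ (noFunnel⇒heavyPaths noFunnel)
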